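{- Let $t \in T$ with $t \geq 10^6$, and suppose $P(t) = 1$. Then $C_3(t) > 5$.
   Context: For positive integers $m, r$, $C_m(r)$ is the minimum odd positive integer $n$ such that there exist vectors $v_1, \ldots, v_n \in \mathbb{Z}^m$ (not necessarily distinct) with $|v_i| = \sqrt{r}$ (Euclidean norm) for every $i$ and $v_1 + \cdots + v_n = \mathbf{0}$; if no such odd $n$ exists, $C_m(r) = 0$. $T$ is the set of positive integers $t \equiv 2 \pmod 4$ whose square-free part has at least one odd prime factor $p$ with $p \equiv 2 \pmod 3$. For a positive integer $z$, $P(z)$ is the number of integer triples $(a,b,c)$ with $0 \leq a \leq b \leq c$ and $a^2 + b^2 + c^2 = z$. -}

module Defs where

open import Data.Integer as ℤ using (ℤ; 0ℤ; +_)
open import Data.List using (List; upTo; length; filter; cartesianProduct)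
open import Data.Nat
open import Data.Nat.DivMod using (_%_)
open import Data.Nat.Divisibility using (_∣_)
open import Data.Nat.Primality using (Prime)
open import Data.Nat.Properties using (≤-antisym)
open import Data.Product using (_×_; _,_; ∃-syntax)
open import Data.Vec as Vec using (Vec)
open import Data.Vec.Relation.Unary.All using (All)
open import Relation.Binary.PropositionalEquality using (_≡_; refl)
open import Relation.Nullary using (¬_; contradiction)
open import Relation.Nullary.Decidable using (Dec; _×-dec_)

Odd : ℕ → Set
Odd n = n % 2 ≡ 1

normSq : ∀ {m} → Vec ℤ m → ℤ
normSq v = Vec.foldr _ ℤ._+_ 0ℤ (Vec.map (λ x → x ℤ.* x) v)

vectorSum : ∀ {m n} → Vec (Vec ℤ m) n → Vec ℤ m
vectorSum {m} = Vec.foldr _ (Vec.zipWith ℤ._+_) (Vec.replicate m 0ℤ)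

-- The condition |v| = √r is expressed as |v|² = r.
ClosedWalk : (m r n : ℕ) → Set
ClosedWalk m r n =
  ∃[ vs ] (All (λ v → normSq v ≡ + r) vs × vectorSum {m} {n} vs ≡ Vec.replicate m 0ℤ)

-- C m [ r ]≔ n is the graph of the function (m , r) ↦ C_m(r): deciding whether
-- some odd closed walk exists is an unbounded search, so C_m(r) is given as a
-- single-valued relation (see C-unique).
data C_[_]≔_ (m r : ℕ) : ℕ → Set where
  least : ∀ {n} → Odd n → ClosedWalk m r n →
          (∀ k → Odd k → ClosedWalk m r k → n ≤ k) → C m [ r ]≔ n
  none  : (∀ k → Odd k → ¬ ClosedWalk m r k) → C m [ r ]≔ 0

C-unique : ∀ {m r n n′} → C m [ r ]≔ n → C m [ r ]≔ n′ → n ≡ n′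
C-unique (least o w l) (least o′ w′ l′) = ≤-antisym (l _ o′ w′) (l′ _ o w)
C-unique (least o w _) (none ¬w)        = contradiction w (¬w _ o)
C-unique (none ¬w)     (least o w _)    = contradiction w (¬w _ o)
C-unique (none _)      (none _)         = refl

SquareFree : ℕ → Set
SquareFree s = ∀ d → d * d ∣ s → d ≡ 1

SquareFreePart : ℕ → ℕ → Set
SquareFreePart t s = SquareFree s × ∃[ k ] t ≡ s * (k * k)

T : ℕ → Set
T t = 0 < t × t % 4 ≡ 2 ×
      ∃[ s ] (SquareFreePart t s ×
              ∃[ p ] (Prime p × Odd p × p % 3 ≡ 2 × p ∣ s))

OrderedRep : ℕ → ℕ × ℕ × ℕ → Set
OrderedRep z (a , b , c) = a ≤ b × b ≤ c × a * a + b * b + c * c ≡ z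

orderedRep? : ∀ z abc → Dec (OrderedRep z abc)
orderedRep? z (a , b , c) =
  a ≤? b ×-dec (b ≤? c ×-dec (a * a + b * b + c * c ≟ z))

-- Enumerating 0 … z in each coordinate misses nothing, as x ≤ x² ≤ z.
P : ℕ → ℕ
P z = length (filter (orderedRep? z) (cartesianProduct I (cartesianProduct I I)))
  where
  I : List ℕ
  I = upTo (suc z)

{-# OPTIONS --safe #-}
-- If P(t) = 1, every integer vector of norm t is a signed permutation of one triple (e, a, b),
-- and t ≡ 2 (mod 4) makes e even and a, b odd.  Each coordinate of a closed walk then gives a
-- relation αe + βa + γb = 0, and parity forces ±e to occur an odd number of times in every
-- coordinate.
--
-- For walks of length at most 5 this leaves two possibilities.  Either ±e ± a ± b = 0, so that
-- t = 2(x² + xy + y²), which is excluded by the prime p ≡ 2 (mod 3) dividing the square-free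
-- part of t; or two of the three relations are not proportional.  In the latter case
-- (e, a, b) = g·d with d primitive and bounded, and t ≥ 10⁶ gives an odd prime q ∣ g.  By
-- Lagrange's theorem q is the norm of an integral quaternion α; rotating d by α, with suitable
-- signs of the coordinates of α, gives a vector of norm q²∣d∣² that is not divisible by q, hence
-- a second representation of t.
--
-- That C₃(t) is not 0 is seen by taking a copies of the cyclic shifts of (e, a, b), whose sum is
-- a(e + a + b)(1, 1, 1), and cancelling it with cyclic shifts of (−a, e, b) and (−a, −e, −b).
module Submission where

open import Data.Nat using (ℕ; _≥_; _>_; _^_)
open import Data.Product using (_×_; ∃-syntax)
open import Relation.Binary.PropositionalEquality using (_≡_)
open import Defs

-- Parity: modulo 2 a coordinate of a closed walk loses its letters e, so the number of its letters
-- ±a, ±b is even, and for odd n the number of its letters ±e is odd. The three coordinates together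
-- hold n letters ±e, so for n at most 5 these counts are 1, 1, 1 or, up to order, 3, 1, 1.
-- Constants: two non-proportional relations fix (e, a, b) up to scale as the cross product of their
-- coefficient vectors. The coefficients are at most 5 in absolute value, so its entries, and with
-- them those of d, are at most 5·5 + 5·5 = 50; g ≤ 2 would then give t ≤ 3·100², below 10⁶. Signs:
-- the vector q·d also has norm q²∣d∣² but represents the same triple, and a rotation of d may
-- happen to be a multiple of q as well. Four sign choices for α are therefore compared, and a
-- second difference shows that they cannot all fail. Minimum: `C` is a relation, so its value must
-- be exhibited. An odd closed walk alone gives only an upper bound; the least length is found by
-- search, which is possible because the entries of vectors of norm t are bounded.

module Squares where
  open import Data.Integer using (+_; -[1+_]; ∣_∣; _*_)
  open import Data.Integer.Properties using (pos-*)
  import Data.Nat as ℕ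
  open import Data.Nat.Properties using (m≤m*n)
  open import Relation.Binary.PropositionalEquality using (refl; sym)

  i*i≡+∣i∣*∣i∣ : ∀ i → i * i ≡ + (∣ i ∣ ℕ.* ∣ i ∣)
  i*i≡+∣i∣*∣i∣ (+ n)    = sym (pos-* n n)
  i*i≡+∣i∣*∣i∣ -[1+ n ] = refl

  n≤n*n : ∀ n → n ℕ.≤ n ℕ.* n
  n≤n*n ℕ.zero      = ℕ.z≤n
  n≤n*n n@(ℕ.suc _) = m≤m*n n n

-- The four-square theorem for odd primes, and rotation by quaternions.

module FourSquares where
  open import Data.Empty using (⊥)
  open import Data.Fin as Fin using (Fin; toℕ; fromℕ<; splitAt)
  import Data.Fin.Properties as Finₚ
  open import Data.Integer using (ℤ; +_; 0ℤ; 1ℤ; ∣_∣; _+_; _-_; _*_; -_; _%ℕ_; _/ℕ_)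
  open import Data.Integer.DivMod using (n%ℕd<d; a≡a%ℕn+[a/ℕn]*n)
  open import Data.Integer.Divisibility.Signed using (divides; ∣⇒∣ᵤ; ∣ᵤ⇒∣; ∣m∣n⇒∣m+n; ∣m∣n⇒∣m-n; ∣m⇒∣-m) renaming (_∣_ to _∣ℤ_; _∣?_ to _∣ℤ?_)
  open import Data.Integer.Properties
  open import Data.Integer.Tactic.RingSolver using (solve-∀)
  open import Data.Nat as ℕ using (ℕ; zero; suc; z≤n; s≤s; NonZero)
  import Data.Nat.Divisibility as ℕ∣
  open import Data.Nat.Induction using (<-rec)
  open import Data.Nat.Primality using (Prime; euclidsLemma; prime⇒irreducible; prime⇒nonZero; prime⇒nonTrivial)
  import Data.Nat.Properties as ℕₚ
  import Data.Nat.Tactic.RingSolver as NatSolver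
  open import Data.Product using (_×_; _,_; ∃-syntax; ∃₂)
  open import Data.Sum using (_⊎_; inj₁; inj₂; [_,_]′)
  open import Relation.Binary.Definitions using (tri<; tri≈; tri>)
  open import Relation.Binary.PropositionalEquality
  open import Relation.Nullary using (¬_; contradiction; Dec; yes; no)
  open Squares

  SumOf4Squares : ℕ → Set
  SumOf4Squares n = ∃[ a ] ∃[ b ] ∃[ c ] ∃[ d ] a * a + b * b + c * c + d * d ≡ + n

  -- The tie 2r = m is kept apart because it is the only case in which 2∣r∣ < m fails; the descent
  -- is strict unless all four remainders are ties. This covers odd and even m at once.
  centredRemainder : ∀ m .{{_ : NonZero m}} (a : ℤ) →
    ∃₂ λ r k → a ≡ r + k * + m × (+ 2 * r ≡ + m ⊎ ∣ r ∣ ℕ.+ ∣ r ∣ ℕ.< m)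
  centredRemainder m a with ℕₚ.<-cmp (a %ℕ m ℕ.+ a %ℕ m) m
  ... | tri< lt _ _ = + (a %ℕ m) , a /ℕ m , a≡a%ℕn+[a/ℕn]*n a m , inj₂ lt
  ... | tri≈ _ eq _ = + (a %ℕ m) , a /ℕ m , a≡a%ℕn+[a/ℕn]*n a m ,
    inj₁ (trans (double (+ (a %ℕ m))) (trans (sym (pos-+ (a %ℕ m) (a %ℕ m))) (cong +_ eq)))
    where
    double : ∀ x → + 2 * x ≡ x + x
    double = solve-∀
  ... | tri> _ _ gt = + r - + m , a /ℕ m + 1ℤ ,
    trans (a≡a%ℕn+[a/ℕn]*n a m) (shift (+ r) (a /ℕ m) (+ m)) , inj₂ small
    where
    r = a %ℕ m
    shift : ∀ r k m → r + k * m ≡ r - m + (k + 1ℤ) * m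
    shift = solve-∀
    r≤m : r ℕ.≤ m
    r≤m = ℕₚ.<⇒≤ (n%ℕd<d a m)
    ∣r-m∣ : ∣ + r - + m ∣ ≡ m ℕ.∸ r
    ∣r-m∣ = trans (cong ∣_∣ (m-n≡m⊖n r m)) (∣⊖∣-≤ r≤m)
    small : ∣ + r - + m ∣ ℕ.+ ∣ + r - + m ∣ ℕ.< m
    small rewrite ∣r-m∣ = ℕₚ.+-cancelʳ-< (r ℕ.+ r) _ _ (begin-strict
      (m ℕ.∸ r) ℕ.+ (m ℕ.∸ r) ℕ.+ (r ℕ.+ r)   ≡⟨ inter (m ℕ.∸ r) r ⟩
      ((m ℕ.∸ r) ℕ.+ r) ℕ.+ ((m ℕ.∸ r) ℕ.+ r) ≡⟨ cong₂ ℕ._+_ (ℕₚ.m∸n+n≡m r≤m) (ℕₚ.m∸n+n≡m r≤m) ⟩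
      m ℕ.+ m                                 <⟨ ℕₚ.+-monoʳ-< m gt ⟩
      m ℕ.+ (r ℕ.+ r)                         ∎)
      where
      open ℕₚ.≤-Reasoning
      inter : ∀ x r → x ℕ.+ x ℕ.+ (r ℕ.+ r) ≡ (x ℕ.+ r) ℕ.+ (x ℕ.+ r)
      inter = NatSolver.solve-∀

  module Descent (q : ℕ) (q-prime : Prime q) where

    -- Euler's descent. The remainders satisfy Σr² = m′m, and Euler's identity writes (Σa²)(Σr²) =
    -- m²m′q as four squares whose roots are all divisible by m because aᵢ ≡ rᵢ. Dividing by m²
    -- represents m′q, with m′ < m.
    step : ∀ m → (∀ {m′} → m′ ℕ.< m → 0 ℕ.< m′ → m′ ℕ.< q → SumOf4Squares (m′ ℕ.* q) → SumOf4Squares q) →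
           0 ℕ.< m → m ℕ.< q → SumOf4Squares (m ℕ.* q) → SumOf4Squares q
    step 1 _ _ _ (a , b , c , d , eq) = a , b , c , d , trans eq (cong +_ (ℕₚ.*-identityˡ q))
    step m@(suc (suc _)) rec 0<m m<q (a₀ , a₁ , a₂ , a₃ , Σa²≡mq)
      with r₀ , k₀ , refl , b₀ ← centredRemainder m a₀
         | r₁ , k₁ , refl , b₁ ← centredRemainder m a₁
         | r₂ , k₂ , refl , b₂ ← centredRemainder m a₂
         | r₃ , k₃ , refl , b₃ ← centredRemainder m a₃
      = conclude b₀ b₁ b₂ b₃
      where
      ρ₀ ρ₁ ρ₂ ρ₃ Σρ² : ℕ
      ρ₀ = ∣ r₀ ∣
      ρ₁ = ∣ r₁ ∣
      ρ₂ = ∣ r₂ ∣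
      ρ₃ = ∣ r₃ ∣
      Σρ² = ρ₀ ℕ.* ρ₀ ℕ.+ ρ₁ ℕ.* ρ₁ ℕ.+ ρ₂ ℕ.* ρ₂ ℕ.+ ρ₃ ℕ.* ρ₃

      Σr²≡Σρ² : r₀ * r₀ + r₁ * r₁ + r₂ * r₂ + r₃ * r₃ ≡ + Σρ²
      Σr²≡Σρ² rewrite i*i≡+∣i∣*∣i∣ r₀ | i*i≡+∣i∣*∣i∣ r₁ | i*i≡+∣i∣*∣i∣ r₂ | i*i≡+∣i∣*∣i∣ r₃ = refl

      Σa²≡m*q : _
      Σa²≡m*q = trans Σa²≡mq (pos-* m q)

      m∤q : ¬ (m ℕ∣.∣ q)
      m∤q m∣q with prime⇒irreducible q-prime m∣q
      ... | inj₁ ()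
      ... | inj₂ m≡q = ℕₚ.<⇒≢ m<q m≡q

      -- If m² divided Σa² = mq, then m would divide the prime q, although 1 < m < q. Both
      -- degenerate cases, m′ = 0 and four ties, end here.
      multiple-of-m² : ∀ x → (r₀ + k₀ * + m) * (r₀ + k₀ * + m) + (r₁ + k₁ * + m) * (r₁ + k₁ * + m)
        + (r₂ + k₂ * + m) * (r₂ + k₂ * + m) + (r₃ + k₃ * + m) * (r₃ + k₃ * + m) ≡ + m * (+ m * x) → ⊥
      multiple-of-m² x eq = m∤q (∣⇒∣ᵤ (divides x (trans
        (*-cancelˡ-≡ (+ m) (+ q) (+ m * x) (trans (sym Σa²≡m*q) eq)) (*-comm (+ m) x))))

      m∣Σρ² : m ℕ∣.∣ Σρ²
      m∣Σρ² = ∣⇒∣ᵤ (divides (+ q - κ) (begin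
        + Σρ²                                 ≡⟨ Σr²≡Σρ² ⟨
        r₀ * r₀ + r₁ * r₁ + r₂ * r₂ + r₃ * r₃ ≡⟨ identity (+ m) r₀ r₁ r₂ r₃ k₀ k₁ k₂ k₃ ⟩
        _                                     ≡⟨ cong (_- κ * + m) Σa²≡m*q ⟩
        + m * + q - κ * + m                   ≡⟨ factor (+ m) (+ q) κ ⟩
        (+ q - κ) * + m                       ∎))
        where
        open ≡-Reasoning
        κ : ℤ
        κ = k₀ * (+ 2 * r₀ + k₀ * + m) + k₁ * (+ 2 * r₁ + k₁ * + m)
          + k₂ * (+ 2 * r₂ + k₂ * + m) + k₃ * (+ 2 * r₃ + k₃ * + m)
        identity : ∀ m r₀ r₁ r₂ r₃ k₀ k₁ k₂ k₃ → r₀ * r₀ + r₁ * r₁ + r₂ * r₂ + r₃ * r₃ ≡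
          (r₀ + k₀ * m) * (r₀ + k₀ * m) + (r₁ + k₁ * m) * (r₁ + k₁ * m)
            + (r₂ + k₂ * m) * (r₂ + k₂ * m) + (r₃ + k₃ * m) * (r₃ + k₃ * m)
          - (k₀ * (+ 2 * r₀ + k₀ * m) + k₁ * (+ 2 * r₁ + k₁ * m) + k₂ * (+ 2 * r₂ + k₂ * m) + k₃ * (+ 2 * r₃ + k₃ * m)) * m
        identity = solve-∀
        factor : ∀ m q x → m * q - x * m ≡ (q - x) * m
        factor = solve-∀

      open ℕ∣._∣_ m∣Σρ² using () renaming (quotient to m′; equality to Σρ²≡m′m)

      Σr²≡m*m′ : r₀ * r₀ + r₁ * r₁ + r₂ * r₂ + r₃ * r₃ ≡ + m * + m′
      Σr²≡m*m′ = trans Σr²≡Σρ² (trans (cong +_ (trans Σρ²≡m′m (ℕₚ.*-comm m′ m))) (pos-* m m′))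

      descend : 0 ℕ.< m′ → m′ ℕ.< m → SumOf4Squares q
      descend 0<m′ m′<m = rec m′<m 0<m′ (ℕₚ.<-trans m′<m m<q) (w₀ , w₁ , w₂ , w₃ ,
        trans (*-cancelˡ-≡ (+ m) _ _ (*-cancelˡ-≡ (+ m) _ _ (begin
          + m * (+ m * (w₀ * w₀ + w₁ * w₁ + w₂ * w₂ + w₃ * w₃))
            ≡⟨ distribute (+ m) (+ m′) K w₁ w₂ w₃ ⟩
          (+ m * + m′ + + m * K) * (+ m * + m′ + + m * K) + _
            ≡⟨ cong (λ R → (R + + m * K) * (R + + m * K) + (+ m * w₁ * (+ m * w₁) + + m * w₂ * (+ m * w₂) + + m * w₃ * (+ m * w₃))) Σr²≡m*m′ ⟨
          _ ≡⟨ euler (+ m) r₀ r₁ r₂ r₃ k₀ k₁ k₂ k₃ ⟨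
          _ ≡⟨ cong₂ _*_ Σa²≡m*q Σr²≡m*m′ ⟩
          + m * + q * (+ m * + m′) ≡⟨ regroup (+ m) (+ q) (+ m′) ⟩
          + m * (+ m * (+ m′ * + q)) ∎))) (sym (pos-* m′ q)))
        where
        open ≡-Reasoning
        K w₀ w₁ w₂ w₃ : ℤ
        -- These are the coordinates of the quaternion product of a with the conjugate of r, divided
        -- by m. The real part is Σr² + mK = m(m′ + K); in the imaginary parts the products of two
        -- remainders cancel, leaving kᵢ in place of aᵢ.
        K  = k₀ * r₀ + k₁ * r₁ + k₂ * r₂ + k₃ * r₃
        w₀ = + m′ + K
        w₁ = k₁ * r₀ - k₀ * r₁ + k₂ * r₃ - k₃ * r₂
        w₂ = k₂ * r₀ - k₀ * r₂ + k₃ * r₁ - k₁ * r₃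
        w₃ = k₃ * r₀ - k₀ * r₃ + k₁ * r₂ - k₂ * r₁
        distribute : ∀ m m′ K w₁ w₂ w₃ → m * (m * ((m′ + K) * (m′ + K) + w₁ * w₁ + w₂ * w₂ + w₃ * w₃)) ≡
          (m * m′ + m * K) * (m * m′ + m * K) + (m * w₁ * (m * w₁) + m * w₂ * (m * w₂) + m * w₃ * (m * w₃))
        distribute = solve-∀
        regroup : ∀ m q m′ → m * q * (m * m′) ≡ m * (m * (m′ * q))
        regroup = solve-∀
        euler : ∀ m r₀ r₁ r₂ r₃ k₀ k₁ k₂ k₃ →
          let R = r₀ * r₀ + r₁ * r₁ + r₂ * r₂ + r₃ * r₃
              K = k₀ * r₀ + k₁ * r₁ + k₂ * r₂ + k₃ * r₃
              w₁ = k₁ * r₀ - k₀ * r₁ + k₂ * r₃ - k₃ * r₂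
              w₂ = k₂ * r₀ - k₀ * r₂ + k₃ * r₁ - k₁ * r₃
              w₃ = k₃ * r₀ - k₀ * r₃ + k₁ * r₂ - k₂ * r₁
          in ((r₀ + k₀ * m) * (r₀ + k₀ * m) + (r₁ + k₁ * m) * (r₁ + k₁ * m)
               + (r₂ + k₂ * m) * (r₂ + k₂ * m) + (r₃ + k₃ * m) * (r₃ + k₃ * m)) * R ≡
             (R + m * K) * (R + m * K) + (m * w₁ * (m * w₁) + m * w₂ * (m * w₂) + m * w₃ * (m * w₃))
        euler = solve-∀

      m′≢0 : m′ ≢ 0
      m′≢0 m′≡0 = multiple-of-m² (k₀ * k₀ + k₁ * k₁ + k₂ * k₂ + k₃ * k₃) (trans
        (cong₂ _+_ (cong₂ _+_ (cong₂ _+_ (sq k₀ (vanish r₀ z₀)) (sq k₁ (vanish r₁ z₁))) (sq k₂ (vanish r₂ z₂))) (sq k₃ (vanish r₃ z₃)))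
        (collect (+ m) k₀ k₁ k₂ k₃))
        where
        Σ≡0 : Σρ² ≡ 0
        Σ≡0 = trans Σρ²≡m′m (cong (ℕ._* m) m′≡0)
        s₂ = ℕₚ.m+n≡0⇒m≡0 (ρ₀ ℕ.* ρ₀ ℕ.+ ρ₁ ℕ.* ρ₁ ℕ.+ ρ₂ ℕ.* ρ₂) Σ≡0
        s₁ = ℕₚ.m+n≡0⇒m≡0 (ρ₀ ℕ.* ρ₀ ℕ.+ ρ₁ ℕ.* ρ₁) s₂
        z₀ = ℕₚ.m+n≡0⇒m≡0 (ρ₀ ℕ.* ρ₀) s₁
        z₁ = ℕₚ.m+n≡0⇒n≡0 (ρ₀ ℕ.* ρ₀) s₁
        z₂ = ℕₚ.m+n≡0⇒n≡0 (ρ₀ ℕ.* ρ₀ ℕ.+ ρ₁ ℕ.* ρ₁) s₂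
        z₃ = ℕₚ.m+n≡0⇒n≡0 (ρ₀ ℕ.* ρ₀ ℕ.+ ρ₁ ℕ.* ρ₁ ℕ.+ ρ₂ ℕ.* ρ₂) Σ≡0
        vanish : ∀ r → ∣ r ∣ ℕ.* ∣ r ∣ ≡ 0 → r ≡ 0ℤ
        vanish r eq with ℕₚ.m*n≡0⇒m≡0∨n≡0 ∣ r ∣ eq
        ... | inj₁ z = ∣i∣≡0⇒i≡0 z
        ... | inj₂ z = ∣i∣≡0⇒i≡0 z
        sq : ∀ k {r} → r ≡ 0ℤ → (r + k * + m) * (r + k * + m) ≡ (k * + m) * (k * + m)
        sq k refl = cong (λ x → x * x) (+-identityˡ (k * + m))
        collect : ∀ m k₀ k₁ k₂ k₃ → k₀ * m * (k₀ * m) + k₁ * m * (k₁ * m) + k₂ * m * (k₂ * m) + k₃ * m * (k₃ * m)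
          ≡ m * (m * (k₀ * k₀ + k₁ * k₁ + k₂ * k₂ + k₃ * k₃))
        collect = solve-∀

      -- Then aᵢ = m/2 + kᵢm, so Σaᵢ² = m²(1 + Σ(kᵢ + kᵢ²)).
      all-halves : + 2 * r₀ ≡ + m → + 2 * r₁ ≡ + m → + 2 * r₂ ≡ + m → + 2 * r₃ ≡ + m → ⊥
      all-halves h₀ h₁ h₂ h₃ = multiple-of-m² X (*-cancelˡ-≡ (+ 4) _ _ (begin
        _ ≡⟨ quadruple (+ m) r₀ r₁ r₂ r₃ k₀ k₁ k₂ k₃ ⟩
        _ ≡⟨ cong₂ _+_ (cong₂ _+_ (cong₂ _+_ (sq k₀ h₀) (sq k₁ h₁)) (sq k₂ h₂)) (sq k₃ h₃) ⟩
        _ ≡⟨ collect (+ m) k₀ k₁ k₂ k₃ ⟩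
        _ ∎))
        where
        open ≡-Reasoning
        X = 1ℤ + (k₀ + k₀ * k₀ + (k₁ + k₁ * k₁) + (k₂ + k₂ * k₂) + (k₃ + k₃ * k₃))
        sq : ∀ k {r} → r ≡ + m → (r + + 2 * k * + m) * (r + + 2 * k * + m) ≡ (+ m + + 2 * k * + m) * (+ m + + 2 * k * + m)
        sq k refl = refl
        quadruple : ∀ m r₀ r₁ r₂ r₃ k₀ k₁ k₂ k₃ →
          + 4 * ((r₀ + k₀ * m) * (r₀ + k₀ * m) + (r₁ + k₁ * m) * (r₁ + k₁ * m)
            + (r₂ + k₂ * m) * (r₂ + k₂ * m) + (r₃ + k₃ * m) * (r₃ + k₃ * m)) ≡
          (+ 2 * r₀ + + 2 * k₀ * m) * (+ 2 * r₀ + + 2 * k₀ * m) + (+ 2 * r₁ + + 2 * k₁ * m) * (+ 2 * r₁ + + 2 * k₁ * m)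
          + (+ 2 * r₂ + + 2 * k₂ * m) * (+ 2 * r₂ + + 2 * k₂ * m) + (+ 2 * r₃ + + 2 * k₃ * m) * (+ 2 * r₃ + + 2 * k₃ * m)
        quadruple = solve-∀
        collect : ∀ m k₀ k₁ k₂ k₃ →
          (m + + 2 * k₀ * m) * (m + + 2 * k₀ * m) + (m + + 2 * k₁ * m) * (m + + 2 * k₁ * m)
          + (m + + 2 * k₂ * m) * (m + + 2 * k₂ * m) + (m + + 2 * k₃ * m) * (m + + 2 * k₃ * m)
          ≡ + 4 * (m * (m * (1ℤ + (k₀ + k₀ * k₀ + (k₁ + k₁ * k₁) + (k₂ + k₂ * k₂) + (k₃ + k₃ * k₃)))))
        collect = solve-∀

      Half : ℤ → Set
      Half r = + 2 * r ≡ + m ⊎ ∣ r ∣ ℕ.+ ∣ r ∣ ℕ.< m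

      weak : ∀ {r} → Half r → ∣ r ∣ ℕ.+ ∣ r ∣ ℕ.≤ m
      weak {r} (inj₁ eq) = ℕₚ.≤-reflexive (trans (cong (∣ r ∣ ℕ.+_) (sym (ℕₚ.+-identityʳ ∣ r ∣))) (trans (sym (abs-* (+ 2) r)) (cong ∣_∣ eq)))
      weak (inj₂ lt) = ℕₚ.<⇒≤ lt

      4Σρ² : ∀ a b c d → 4 ℕ.* (a ℕ.* a ℕ.+ b ℕ.* b ℕ.+ c ℕ.* c ℕ.+ d ℕ.* d) ≡
        (a ℕ.+ a) ℕ.* (a ℕ.+ a) ℕ.+ (b ℕ.+ b) ℕ.* (b ℕ.+ b) ℕ.+ (c ℕ.+ c) ℕ.* (c ℕ.+ c) ℕ.+ (d ℕ.+ d) ℕ.* (d ℕ.+ d)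
      4Σρ² = NatSolver.solve-∀

      m*m : ℕ
      m*m = m ℕ.* m

      sq≤ : ∀ {x} → x ℕ.≤ m → x ℕ.* x ℕ.≤ m*m
      sq≤ p = ℕₚ.*-mono-≤ p p

      sq< : ∀ {x} → x ℕ.< m → x ℕ.* x ℕ.< m*m
      sq< p = ℕₚ.*-mono-< p p

      conclude-< : (ρ₀ ℕ.+ ρ₀) ℕ.* (ρ₀ ℕ.+ ρ₀) ℕ.+ (ρ₁ ℕ.+ ρ₁) ℕ.* (ρ₁ ℕ.+ ρ₁)
        ℕ.+ (ρ₂ ℕ.+ ρ₂) ℕ.* (ρ₂ ℕ.+ ρ₂) ℕ.+ (ρ₃ ℕ.+ ρ₃) ℕ.* (ρ₃ ℕ.+ ρ₃)
        ℕ.< m*m ℕ.+ m*m ℕ.+ m*m ℕ.+ m*m → SumOf4Squares q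
      conclude-< lt = descend (ℕₚ.n≢0⇒n>0 m′≢0) (ℕₚ.*-cancelʳ-< m m′ m (ℕₚ.*-cancelˡ-< 4 (m′ ℕ.* m) m*m (begin-strict
        4 ℕ.* (m′ ℕ.* m) ≡⟨ cong (4 ℕ.*_) Σρ²≡m′m ⟨
        4 ℕ.* Σρ²        ≡⟨ 4Σρ² ρ₀ ρ₁ ρ₂ ρ₃ ⟩
        _                <⟨ lt ⟩
        m*m ℕ.+ m*m ℕ.+ m*m ℕ.+ m*m ≡⟨ four m*m ⟩
        4 ℕ.* m*m ∎)))
        where
        open ℕₚ.≤-Reasoning
        four : ∀ x → x ℕ.+ x ℕ.+ x ℕ.+ x ≡ 4 ℕ.* x
        four = NatSolver.solve-∀

      conclude : Half r₀ → Half r₁ → Half r₂ → Half r₃ → SumOf4Squares q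
      conclude (inj₁ h₀) (inj₁ h₁) (inj₁ h₂) (inj₁ h₃) = contradiction h₃ (all-halves h₀ h₁ h₂)
      conclude (inj₂ l₀) b₁ b₂ b₃ = conclude-<
        (ℕₚ.+-mono-<-≤ (ℕₚ.+-mono-<-≤ (ℕₚ.+-mono-<-≤ (sq< l₀) (sq≤ (weak b₁))) (sq≤ (weak b₂))) (sq≤ (weak b₃)))
      conclude b₀ (inj₂ l₁) b₂ b₃ = conclude-<
        (ℕₚ.+-mono-<-≤ (ℕₚ.+-mono-<-≤ (ℕₚ.+-mono-≤-< (sq≤ (weak b₀)) (sq< l₁)) (sq≤ (weak b₂))) (sq≤ (weak b₃)))
      conclude b₀ b₁ (inj₂ l₂) b₃ = conclude-<
        (ℕₚ.+-mono-<-≤ (ℕₚ.+-mono-≤-< (ℕₚ.+-mono-≤ (sq≤ (weak b₀)) (sq≤ (weak b₁))) (sq< l₂)) (sq≤ (weak b₃)))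
      conclude b₀ b₁ b₂ (inj₂ l₃) = conclude-<
        (ℕₚ.+-mono-≤-< (ℕₚ.+-mono-≤ (ℕₚ.+-mono-≤ (sq≤ (weak b₀)) (sq≤ (weak b₁))) (sq≤ (weak b₂))) (sq< l₃))

    descent : ∀ m → 0 ℕ.< m → m ℕ.< q → SumOf4Squares (m ℕ.* q) → SumOf4Squares q
    descent = <-rec _ step

  %ℕ-≡⇒∣- : ∀ q .{{_ : NonZero q}} i j → i %ℕ q ≡ j %ℕ q → + q ∣ℤ i - j
  %ℕ-≡⇒∣- q i j eq = divides (i /ℕ q - j /ℕ q) (begin
    i - j                                                   ≡⟨ cong₂ _-_ (a≡a%ℕn+[a/ℕn]*n i q) (a≡a%ℕn+[a/ℕn]*n j q) ⟩
    + (i %ℕ q) + i /ℕ q * + q - (+ (j %ℕ q) + j /ℕ q * + q) ≡⟨ cong (λ r → + r + i /ℕ q * + q - (+ (j %ℕ q) + j /ℕ q * + q)) eq ⟩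
    + (j %ℕ q) + i /ℕ q * + q - (+ (j %ℕ q) + j /ℕ q * + q) ≡⟨ cancel (+ (j %ℕ q)) (i /ℕ q) (j /ℕ q) (+ q) ⟩
    (i /ℕ q - j /ℕ q) * + q                                 ∎)
    where
    open ≡-Reasoning
    cancel : ∀ r x y q → r + x * q - (r + y * q) ≡ (x - y) * q
    cancel = solve-∀

  0<n<q⇒q∤n : ∀ {q n} → 0 ℕ.< n → n ℕ.< q → ¬ (q ℕ∣.∣ n)
  0<n<q⇒q∤n {n = suc _} _ n<q q∣n = ℕₚ.<⇒≱ n<q (ℕ∣.∣⇒≤ q∣n)

  -- Both factors of y² - x² = (y - x)(y + x) lie strictly between 0 and q.
  squares-incongruent : ∀ {q h} → Prime q → q ≡ suc (h ℕ.+ h) → ∀ {x y} → x ℕ.< y → y ℕ.≤ h →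
                        ¬ (+ q ∣ℤ + y * + y - + x * + x)
  squares-incongruent {q} {h} pr q≡ {x} {y} x<y y≤h q∣ =
    [ 0<n<q⇒q∤n (ℕₚ.m<n⇒0<n∸m x<y) (ℕₚ.≤-<-trans (ℕₚ.≤-trans (ℕₚ.m∸n≤m y x) y≤h) (subst (h ℕ.<_) (sym q≡) (s≤s (ℕₚ.m≤m+n h h))))
    , 0<n<q⇒q∤n (ℕₚ.<-≤-trans (ℕₚ.≤-<-trans z≤n x<y) (ℕₚ.m≤m+n y x))
             (subst (y ℕ.+ x ℕ.<_) (sym q≡) (s≤s (ℕₚ.+-mono-≤ y≤h (ℕₚ.≤-trans (ℕₚ.<⇒≤ x<y) y≤h)))) ]′
    (euclidsLemma (y ℕ.∸ x) (y ℕ.+ x) pr (subst (q ℕ∣.∣_) (trans (cong ∣_∣ factored) (abs-* (+ (y ℕ.∸ x)) (+ (y ℕ.+ x)))) (∣⇒∣ᵤ q∣)))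
    where
    expand : ∀ x y → y * y - x * x ≡ (y - x) * (y + x)
    expand = solve-∀
    factored : + y * + y - + x * + x ≡ + (y ℕ.∸ x) * + (y ℕ.+ x)
    factored = trans (expand (+ x) (+ y)) (cong (_* + (y ℕ.+ x)) (trans (m-n≡m⊖n y x) (⊖-≥ (ℕₚ.<⇒≤ x<y))))

  -- The h + 1 values x² and the h + 1 values -(y² + 1) number q + 1, so two agree modulo q. By
  -- `squares-incongruent` they do not come from the same family.
  x²+y²≡-1 : ∀ {q h} → Prime q → q ≡ suc (h ℕ.+ h) →
             ∃₂ λ x y → x ℕ.≤ h × y ℕ.≤ h × q ℕ∣.∣ x ℕ.* x ℕ.+ y ℕ.* y ℕ.+ 1
  x²+y²≡-1 {q} {h} pr q≡ = collide (Finₚ.pigeonhole q<2h+2 residue)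
    where
    instance
      q≢0 : NonZero q
      q≢0 = prime⇒nonZero pr
    value : Fin (suc h) ⊎ Fin (suc h) → ℤ
    value (inj₁ x) = + toℕ x * + toℕ x
    value (inj₂ y) = - (+ toℕ y * + toℕ y + 1ℤ)
    residue : Fin (suc h ℕ.+ suc h) → Fin q
    residue i = fromℕ< (n%ℕd<d (value (splitAt (suc h) i)) q)
    q<2h+2 : q ℕ.< suc h ℕ.+ suc h
    q<2h+2 = subst₂ ℕ._<_ (sym q≡) (cong suc (sym (ℕₚ.+-suc h h))) ℕₚ.≤-refl
    toℕ≤h : (x : Fin (suc h)) → toℕ x ℕ.≤ h
    toℕ≤h x = ℕ.s≤s⁻¹ (Finₚ.toℕ<n x)
    distinct : ∀ (x y : Fin (suc h)) → x ≢ y → ¬ (+ q ∣ℤ + toℕ y * + toℕ y - + toℕ x * + toℕ x)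
    distinct x y x≢y q∣ with ℕₚ.<-cmp (toℕ x) (toℕ y)
    ... | tri< lt _ _ = squares-incongruent pr q≡ lt (toℕ≤h y) q∣
    ... | tri≈ _ eq _ = x≢y (Finₚ.toℕ-injective eq)
    ... | tri> _ _ gt = squares-incongruent pr q≡ gt (toℕ≤h x)
      (subst (+ q ∣ℤ_) (swap (+ toℕ x * + toℕ x) (+ toℕ y * + toℕ y)) (∣m⇒∣-m q∣))
      where
      swap : ∀ a b → - (b - a) ≡ a - b
      swap = solve-∀
    solution : ∀ (x y : Fin (suc h)) → + q ∣ℤ + toℕ x * + toℕ x + + toℕ y * + toℕ y + 1ℤ →
               ∃₂ λ x y → x ℕ.≤ h × y ℕ.≤ h × q ℕ∣.∣ x ℕ.* x ℕ.+ y ℕ.* y ℕ.+ 1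
    solution x y q∣ = toℕ x , toℕ y , toℕ≤h x , toℕ≤h y ,
      subst (q ℕ∣.∣_) (cong ∣_∣ (cong₂ (λ a b → a + b + 1ℤ) (sym (pos-* (toℕ x) (toℕ x))) (sym (pos-* (toℕ y) (toℕ y))))) (∣⇒∣ᵤ q∣)
    collide : ∃₂ (λ i j → i Fin.< j × residue i ≡ residue j) →
              ∃₂ λ x y → x ℕ.≤ h × y ℕ.≤ h × q ℕ∣.∣ x ℕ.* x ℕ.+ y ℕ.* y ℕ.+ 1
    collide (i , j , i<j , eq)
      with splitAt (suc h) i | splitAt (suc h) j | Finₚ.join-splitAt (suc h) (suc h) i | Finₚ.join-splitAt (suc h) (suc h) j
         | %ℕ-≡⇒∣- q (value (splitAt (suc h) i)) (value (splitAt (suc h) j)) (Finₚ.fromℕ<-injective _ _ _ _ eq)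
    ... | inj₁ x | inj₁ y | refl | refl | q∣ = contradiction q∣ (distinct y x λ { refl → ℕₚ.<-irrefl refl i<j })
    ... | inj₁ x | inj₂ y | _ | _ | q∣ = solution x y (subst (+ q ∣ℤ_) (rearrange (+ toℕ x * + toℕ x) (+ toℕ y * + toℕ y)) q∣)
      where
      rearrange : ∀ a b → a - - (b + 1ℤ) ≡ a + b + 1ℤ
      rearrange = solve-∀
    ... | inj₂ x | inj₁ y | _ | _ | q∣ = solution x y (subst (+ q ∣ℤ_) (rearrange (+ toℕ x * + toℕ x) (+ toℕ y * + toℕ y)) (∣m⇒∣-m q∣))
      where
      rearrange : ∀ a b → - (- (a + 1ℤ) - b) ≡ a + b + 1ℤ
      rearrange = solve-∀
    ... | inj₂ x | inj₂ y | refl | refl | q∣ = contradiction (subst (+ q ∣ℤ_) (rearrange (+ toℕ x * + toℕ x) (+ toℕ y * + toℕ y)) q∣)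
        (distinct x y λ { refl → ℕₚ.<-irrefl refl i<j })
      where
      rearrange : ∀ a b → - (a + 1ℤ) - - (b + 1ℤ) ≡ b - a
      rearrange = solve-∀

  -- The descent starts from x² + y² + 1² + 0² = mq. Since x and y are at most h = (q - 1)/2, the
  -- left side is at most 2h² + 1 < q², so m < q.
  oddPrime⇒sumOf4Squares : ∀ {q h} → Prime q → q ≡ suc (h ℕ.+ h) → SumOf4Squares q
  oddPrime⇒sumOf4Squares {q} {h} pr q≡
    with x , y , x≤h , y≤h , ℕ∣.divides m eq ← x²+y²≡-1 {h = h} pr q≡
    = Descent.descent q pr m (ℕₚ.n≢0⇒n>0 m≢0) m<q
        (+ x , + y , 1ℤ , 0ℤ , trans (cong₂ (λ a b → a + b + 1ℤ + 0ℤ) (sym (pos-* x x)) (sym (pos-* y y)))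
          (trans (+-identityʳ _) (cong +_ eq)))
    where
    m≢0 : m ≢ 0
    m≢0 refl = ℕₚ.1+n≢0 (trans (ℕₚ.+-comm 1 (x ℕ.* x ℕ.+ y ℕ.* y)) eq)
    square : ∀ h → h ℕ.* h ℕ.+ h ℕ.* h ℕ.+ 1 ℕ.+ (h ℕ.+ h ℕ.+ h ℕ.+ h ℕ.+ h ℕ.* h ℕ.+ h ℕ.* h) ≡ suc (h ℕ.+ h) ℕ.* suc (h ℕ.+ h)
    square = NatSolver.solve-∀
    q≢1 : h ≢ 0
    q≢1 refl = ℕ.nonTrivial⇒≢1 {{prime⇒nonTrivial pr}} q≡
    m<q : m ℕ.< q
    m<q = ℕₚ.*-cancelʳ-< q m q (begin-strict
      m ℕ.* q                         ≡⟨ eq ⟨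
      x ℕ.* x ℕ.+ y ℕ.* y ℕ.+ 1       ≤⟨ ℕₚ.+-monoˡ-≤ 1 (ℕₚ.+-mono-≤ (ℕₚ.*-mono-≤ x≤h x≤h) (ℕₚ.*-mono-≤ y≤h y≤h)) ⟩
      h ℕ.* h ℕ.+ h ℕ.* h ℕ.+ 1       <⟨ ℕₚ.m<m+n _ (ℕₚ.<-≤-trans (ℕₚ.n≢0⇒n>0 q≢1) (subst (h ℕ.≤_) (sym (assoc h)) (ℕₚ.m≤m+n h _))) ⟩
      _                               ≡⟨ square h ⟩
      suc (h ℕ.+ h) ℕ.* suc (h ℕ.+ h) ≡⟨ cong₂ ℕ._*_ q≡ q≡ ⟨
      q ℕ.* q                         ∎)
      where
      open ℕₚ.≤-Reasoning
      assoc : ∀ h → h ℕ.+ h ℕ.+ h ℕ.+ h ℕ.+ h ℕ.* h ℕ.+ h ℕ.* h ≡ h ℕ.+ (h ℕ.+ h ℕ.+ h ℕ.+ h ℕ.* h ℕ.+ h ℕ.* h)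
      assoc = NatSolver.solve-∀

  prime≢square : ∀ {q} → Prime q → ∀ a → + q ≢ a * a
  prime≢square {q} pr a eq with prime⇒irreducible pr (ℕ∣.divides ∣ a ∣ (trans (cong ∣_∣ eq) (abs-* a a)))
  ... | inj₁ ∣a∣≡1 = ℕ.nonTrivial⇒≢1 {{prime⇒nonTrivial pr}} (trans (trans (cong ∣_∣ eq) (abs-* a a)) (cong₂ ℕ._*_ ∣a∣≡1 ∣a∣≡1))
  ... | inj₂ ∣a∣≡q = ℕ.nonTrivial⇒≢1 {{prime⇒nonTrivial pr}} (sym (ℕₚ.*-cancelˡ-≡ 1 q q {{prime⇒nonZero pr}}
    (trans (ℕₚ.*-identityʳ q) (trans (trans (cong ∣_∣ eq) (abs-* a a)) (cong₂ ℕ._*_ ∣a∣≡q ∣a∣≡q)))))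

  -- A prime is not a square, so at least two coordinates are nonzero. They are moved to the
  -- positions a and c, whose product appears in `rot₁-polarised`.
  sumOf4Squares-a≢0≢c : ∀ {q} → Prime q → SumOf4Squares q →
    ∃[ a ] ∃[ b ] ∃[ c ] ∃[ d ] (a ≢ 0ℤ × c ≢ 0ℤ × a * a + b * b + c * c + d * d ≡ + q)
  sumOf4Squares-a≢0≢c {q} pr (a , b , c , d , eq)
    with a ≟ 0ℤ | b ≟ 0ℤ | c ≟ 0ℤ | d ≟ 0ℤ
  ... | no a≢0 | _      | no c≢0 | _      = a , b , c , d , a≢0 , c≢0 , eq
  ... | no a≢0 | no b≢0 | _      | _      = a , c , b , d , a≢0 , b≢0 , trans (swap a b c d) eq
    where
    swap : ∀ a b c d → a * a + c * c + b * b + d * d ≡ a * a + b * b + c * c + d * d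
    swap = solve-∀
  ... | no a≢0 | _      | _      | no d≢0 = a , b , d , c , a≢0 , d≢0 , trans (swap a b c d) eq
    where
    swap : ∀ a b c d → a * a + b * b + d * d + c * c ≡ a * a + b * b + c * c + d * d
    swap = solve-∀
  ... | _      | no b≢0 | no c≢0 | _      = b , a , c , d , b≢0 , c≢0 , trans (swap a b c d) eq
    where
    swap : ∀ a b c d → b * b + a * a + c * c + d * d ≡ a * a + b * b + c * c + d * d
    swap = solve-∀
  ... | _      | no b≢0 | _      | no d≢0 = b , a , d , c , b≢0 , d≢0 , trans (swap a b c d) eq
    where
    swap : ∀ a b c d → b * b + a * a + d * d + c * c ≡ a * a + b * b + c * c + d * d
    swap = solve-∀
  ... | _      | _      | no c≢0 | no d≢0 = c , a , d , b , c≢0 , d≢0 , trans (swap a b c d) eq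
    where
    swap : ∀ a b c d → c * c + a * a + d * d + b * b ≡ a * a + b * b + c * c + d * d
    swap = solve-∀
  ... | _        | yes refl | yes refl | yes refl = contradiction (trans (sym eq) (only a)) (prime≢square pr a)
    where
    only : ∀ x → x * x + 0ℤ * 0ℤ + 0ℤ * 0ℤ + 0ℤ * 0ℤ ≡ x * x
    only = solve-∀
  ... | yes refl | _        | yes refl | yes refl = contradiction (trans (sym eq) (only b)) (prime≢square pr b)
    where
    only : ∀ x → 0ℤ * 0ℤ + x * x + 0ℤ * 0ℤ + 0ℤ * 0ℤ ≡ x * x
    only = solve-∀
  ... | yes refl | yes refl | _        | yes refl = contradiction (trans (sym eq) (only c)) (prime≢square pr c)
    where
    only : ∀ x → 0ℤ * 0ℤ + 0ℤ * 0ℤ + x * x + 0ℤ * 0ℤ ≡ x * x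
    only = solve-∀
  ... | yes refl | yes refl | yes refl | _        = contradiction (trans (sym eq) (only d)) (prime≢square pr d)
    where
    only : ∀ x → 0ℤ * 0ℤ + 0ℤ * 0ℤ + 0ℤ * 0ℤ + x * x ≡ x * x
    only = solve-∀

  -- The three coordinates of α v ᾱ for the quaternion α = a + bi + cj + dk and v = xi + yj + zk.
  rot₁ rot₂ rot₃ : (a b c d x y z : ℤ) → ℤ
  rot₁ a b c d x y z = (a * a + b * b - c * c - d * d) * x + + 2 * (b * c - a * d) * y + + 2 * (b * d + a * c) * z
  rot₂ a b c d x y z = + 2 * (b * c + a * d) * x + (a * a - b * b + c * c - d * d) * y + + 2 * (c * d - a * b) * z
  rot₃ a b c d x y z = + 2 * (b * d - a * c) * x + + 2 * (c * d + a * b) * y + (a * a - b * b - c * c + d * d) * z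

  rot-norm : ∀ a b c d x y z →
    let w₁ = rot₁ a b c d x y z
        w₂ = rot₂ a b c d x y z
        w₃ = rot₃ a b c d x y z
    in w₁ * w₁ + w₂ * w₂ + w₃ * w₃ ≡
       (a * a + b * b + c * c + d * d) * (a * a + b * b + c * c + d * d) * (x * x + y * y + z * z)
  rot-norm a b c d x y z = expand a b c d x y z
    where
    expand : ∀ a b c d x y z →
      let N = a * a + b * b + c * c + d * d
          w₁ = (a * a + b * b - c * c - d * d) * x + + 2 * (b * c - a * d) * y + + 2 * (b * d + a * c) * z
          w₂ = + 2 * (b * c + a * d) * x + (a * a - b * b + c * c - d * d) * y + + 2 * (c * d - a * b) * z
          w₃ = + 2 * (b * d - a * c) * x + + 2 * (c * d + a * b) * y + (a * a - b * b - c * c + d * d) * z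
      in w₁ * w₁ + w₂ * w₂ + w₃ * w₃ ≡ N * N * (x * x + y * y + z * z)
    expand = solve-∀

  -- Only the term 2acz of rot₁ changes sign under both a ↦ −a and c ↦ −c separately.
  rot₁-polarised : ∀ a b c d x y z →
    rot₁ a b c d x y z - rot₁ (- a) b c d x y z - rot₁ a b (- c) d x y z + rot₁ (- a) b (- c) d x y z ≡ + 8 * (a * c * z)
  rot₁-polarised a b c d x y z = expand a b c d x y z
    where
    expand : ∀ a b c d x y z →
      let w = λ a c → (a * a + b * b - c * c - d * d) * x + + 2 * (b * c - a * d) * y + + 2 * (b * d + a * c) * z
      in w a c - w (- a) c - w a (- c) + w (- a) (- c) ≡ + 8 * (a * c * z)
    expand = solve-∀

  -- Changing the signs of a and c keeps the norm of α equal to q. Were the first coordinate of all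
  -- four rotated vectors divisible by q, then q would divide 8acz by `rot₁-polarised`; but q is
  -- odd, does not divide z, and exceeds the nonzero ∣a∣ and ∣c∣.
  secondRep : ∀ {q h} → Prime q → q ≡ suc (h ℕ.+ h) → ∀ x y z → ¬ (q ℕ∣.∣ ∣ z ∣) →
    ∃[ w₁ ] ∃[ w₂ ] ∃[ w₃ ] (¬ (q ℕ∣.∣ ∣ w₁ ∣) ×
      w₁ * w₁ + w₂ * w₂ + w₃ * w₃ ≡ + q * + q * (x * x + y * y + z * z))
  secondRep {q} {h} pr q≡ x y z q∤z = rotate (sumOf4Squares-a≢0≢c pr (oddPrime⇒sumOf4Squares {h = h} pr q≡))
    where
    Goal : Set
    Goal = ∃[ w₁ ] ∃[ w₂ ] ∃[ w₃ ] (¬ (q ℕ∣.∣ ∣ w₁ ∣) ×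
      w₁ * w₁ + w₂ * w₂ + w₃ * w₃ ≡ + q * + q * (x * x + y * y + z * z))

    rotate : ∃[ a ] ∃[ b ] ∃[ c ] ∃[ d ] (a ≢ 0ℤ × c ≢ 0ℤ × a * a + b * b + c * c + d * d ≡ + q) → Goal
    rotate (a , b , c , d , a≢0 , c≢0 , N≡q) = search (try a c N≡q)
        (try (- a) c (trans (cong (λ s → s + b * b + c * c + d * d) (-a² a)) N≡q))
        (try a (- c) (trans (cong (λ s → a * a + b * b + s + d * d) (-a² c)) N≡q))
        (try (- a) (- c) (trans (cong₂ (λ s t → s + b * b + t + d * d) (-a² a) (-a² c)) N≡q))
      where
      try : ∀ a c → a * a + b * b + c * c + d * d ≡ + q → Goal ⊎ + q ∣ℤ rot₁ a b c d x y z
      try a c N≡q = fromDec (+ q ∣ℤ? rot₁ a b c d x y z)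
        where
        fromDec : Dec (+ q ∣ℤ rot₁ a b c d x y z) → Goal ⊎ + q ∣ℤ rot₁ a b c d x y z
        fromDec (yes q∣w) = inj₂ q∣w
        fromDec (no q∤w)  = inj₁ (rot₁ a b c d x y z , rot₂ a b c d x y z , rot₃ a b c d x y z , (λ q∣w → q∤w (∣ᵤ⇒∣ q∣w)) ,
          trans (rot-norm a b c d x y z) (cong (λ N → N * N * (x * x + y * y + z * z)) N≡q))

      -a² : ∀ a → - a * - a ≡ a * a
      -a² = solve-∀

      q∤2 : ¬ (q ℕ∣.∣ 2)
      q∤2 q∣2 = ℕₚ.<⇒≱ (subst (2 ℕ.<_) (sym q≡) (two h q≡)) (ℕ∣.∣⇒≤ q∣2)
        where
        two : ∀ h → q ≡ suc (h ℕ.+ h) → 2 ℕ.< suc (h ℕ.+ h)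
        two zero    q≡1 = contradiction q≡1 (ℕ.nonTrivial⇒≢1 {{prime⇒nonTrivial pr}})
        two (suc h) _   = s≤s (s≤s (subst (1 ℕ.≤_) (sym (ℕₚ.+-suc h h)) (s≤s z≤n)))

      -- A nonzero i with i² ≤ q < q² satisfies 0 < ∣i∣ < q.
      q∤ : ∀ i → i ≢ 0ℤ → ∣ i ∣ ℕ.* ∣ i ∣ ℕ.≤ q → ¬ (q ℕ∣.∣ ∣ i ∣)
      q∤ i i≢0 i²≤q = 0<n<q⇒q∤n (ℕₚ.n≢0⇒n>0 λ z → i≢0 (∣i∣≡0⇒i≡0 z))
        (ℕₚ.≰⇒> λ q≤i → ℕₚ.<⇒≱ (ℕₚ.m<m*n q q {{prime⇒nonZero pr}} (ℕ.nonTrivial⇒n>1 q {{prime⇒nonTrivial pr}}))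
          (ℕₚ.≤-trans (ℕₚ.*-mono-≤ q≤i q≤i) i²≤q))

      ∣N∣ : ∣ a ∣ ℕ.* ∣ a ∣ ℕ.+ ∣ b ∣ ℕ.* ∣ b ∣ ℕ.+ ∣ c ∣ ℕ.* ∣ c ∣ ℕ.+ ∣ d ∣ ℕ.* ∣ d ∣ ≡ q
      ∣N∣ = +-injective (trans (sym N) N≡q)
        where
        N : a * a + b * b + c * c + d * d ≡ + (∣ a ∣ ℕ.* ∣ a ∣ ℕ.+ ∣ b ∣ ℕ.* ∣ b ∣ ℕ.+ ∣ c ∣ ℕ.* ∣ c ∣ ℕ.+ ∣ d ∣ ℕ.* ∣ d ∣)
        N rewrite i*i≡+∣i∣*∣i∣ a | i*i≡+∣i∣*∣i∣ b | i*i≡+∣i∣*∣i∣ c | i*i≡+∣i∣*∣i∣ d = refl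

      q∤a : ¬ (q ℕ∣.∣ ∣ a ∣)
      q∤a = q∤ a a≢0 (subst (∣ a ∣ ℕ.* ∣ a ∣ ℕ.≤_) ∣N∣ (ℕₚ.≤-trans (ℕₚ.m≤m+n _ _) (ℕₚ.≤-trans (ℕₚ.m≤m+n _ _) (ℕₚ.m≤m+n _ _))))

      q∤c : ¬ (q ℕ∣.∣ ∣ c ∣)
      q∤c = q∤ c c≢0 (subst (∣ c ∣ ℕ.* ∣ c ∣ ℕ.≤_) ∣N∣ (ℕₚ.≤-trans (ℕₚ.m≤n+m _ (∣ a ∣ ℕ.* ∣ a ∣ ℕ.+ ∣ b ∣ ℕ.* ∣ b ∣)) (ℕₚ.m≤m+n _ _)))

      q∤product : ¬ (+ q ∣ℤ + 8 * (a * c * z))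
      q∤product q∣ with euclidsLemma 8 ∣ a * c * z ∣ pr (subst (q ℕ∣.∣_) (abs-* (+ 8) (a * c * z)) (∣⇒∣ᵤ q∣))
      ... | inj₁ q∣8 with euclidsLemma 2 4 pr q∣8
      ...   | inj₁ q∣2 = q∤2 q∣2
      ...   | inj₂ q∣4 = [ q∤2 , q∤2 ]′ (euclidsLemma 2 2 pr q∣4)
      q∤product q∣ | inj₂ q∣acz with euclidsLemma ∣ a * c ∣ ∣ z ∣ pr (subst (q ℕ∣.∣_) (abs-* (a * c) z) q∣acz)
      ... | inj₂ q∣z  = q∤z q∣z
      ... | inj₁ q∣ac = [ q∤a , q∤c ]′ (euclidsLemma ∣ a ∣ ∣ c ∣ pr (subst (q ℕ∣.∣_) (abs-* a c) q∣ac))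

      search : Goal ⊎ + q ∣ℤ rot₁ a b c d x y z → Goal ⊎ + q ∣ℤ rot₁ (- a) b c d x y z →
               Goal ⊎ + q ∣ℤ rot₁ a b (- c) d x y z → Goal ⊎ + q ∣ℤ rot₁ (- a) b (- c) d x y z → Goal
      search (inj₁ g) _ _ _ = g
      search _ (inj₁ g) _ _ = g
      search _ _ (inj₁ g) _ = g
      search _ _ _ (inj₁ g) = g
      search (inj₂ d₁) (inj₂ d₂) (inj₂ d₃) (inj₂ d₄) = contradiction
        (subst (+ q ∣ℤ_) (rot₁-polarised a b c d x y z)
          (∣m∣n⇒∣m+n {m = w₁ - w₂ - w₃} {n = w₄} (∣m∣n⇒∣m-n {m = w₁ - w₂} {n = w₃} (∣m∣n⇒∣m-n {m = w₁} {n = w₂} d₁ d₂) d₃) d₄)) q∤product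
        where
        w₁ = rot₁ a b c d x y z
        w₂ = rot₁ (- a) b c d x y z
        w₃ = rot₁ a b (- c) d x y z
        w₄ = rot₁ (- a) b (- c) d x y z

-- Fermat's little theorem and the form x² + xy + y² at primes p ≡ 2 (mod 3).

module EisensteinForm where
  open import Data.Empty using (⊥)
  import Algebra.Properties.CommutativeSemiring.Binomial as Binomial
  open import Algebra.Properties.Monoid.Sum using (sum-init-last)
  open import Data.Fin using (zero; suc; toℕ; inject₁)
  open import Data.Fin.Properties using (toℕ<n; toℕ-inject₁; toℕ-fromℕ)
  open import Data.Integer as ℤ using (+_) renaming (_+_ to _⊕_; _*_ to _⊗_; _-_ to _⊖_)
  open import Data.Integer.Divisibility.Signed as ℤ∣ using (divides; ∣⇒∣ᵤ; ∣ᵤ⇒∣) renaming (_∣_ to _∣ℤ_)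
  import Data.Integer.Properties as ℤₚ
  import Data.Integer.Tactic.RingSolver as IntSolver
  open import Data.Nat
  open import Data.Nat.Combinatorics using (_C_; nCk≡n!/k![n-k]!; k![n∸k]!∣n!; nCn≡1)
  open import Data.Nat.Divisibility using (_∣_; ∣⇒≤; m∣m*n; ∣m⇒∣m*n; ∣m∣n⇒∣m+n; ∣1⇒≡1; _∣0) renaming (divides to divides-ℕ)
  open import Data.Nat.DivMod using (m/n*n≡m; m≡m%n+[m/n]*n)
  open import Data.Nat.Induction using (<-rec)
  open import Data.Nat.Primality using (Prime; euclidsLemma; prime⇒nonZero; prime⇒nonTrivial)
  open import Data.Nat.Properties
  open import Data.Nat.Tactic.RingSolver using (solve-∀)
  open import Data.Product using (_×_; _,_; ∃-syntax)
  open import Data.Sum using (_⊎_; inj₁; inj₂; [_,_]′)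
  open import Data.Vec.Functional using (Vector; tail; init; last)
  open import Relation.Binary.PropositionalEquality
  open import Relation.Nullary using (¬_; contradiction)
  open Binomial +-*-commutativeSemiring using (binomialTerm) renaming (theorem to binomialTheorem)
  open import Algebra.Properties.Semiring.Exp +-*-semiring using () renaming (_^_ to _^′_)
  open import Algebra.Properties.Semiring.Mult +-*-semiring using () renaming (_×_ to _×′_)
  open import Algebra.Properties.Semiring.Sum +-*-semiring using (sum)

  prime∤! : ∀ {p} → Prime p → ∀ k → k < p → ¬ (p ∣ k !)
  prime∤! pr zero _ p∣1 = nonTrivial⇒≢1 {{prime⇒nonTrivial pr}} (∣1⇒≡1 p∣1)
  prime∤! pr (suc k) k<p p∣ with euclidsLemma (suc k) (k !) pr p∣
  ... | inj₁ p∣k+1 = <⇒≱ k<p (∣⇒≤ p∣k+1)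
  ... | inj₂ p∣k!  = prime∤! pr k (<-trans (n<1+n k) k<p) p∣k!

  -- The prime p = n + 1 divides p! = C(p,k)·k!·(p - k)!, but neither of the two factorials, which
  -- involve only numbers below p.
  prime∣C : ∀ {n k} → Prime (suc n) → 0 < k → k ≤ n → suc n ∣ suc n C k
  prime∣C {n} {k} pr 0<k k≤n with euclidsLemma (suc n C k) (k ! * (suc n ∸ k) !) pr (subst (suc n ∣_) factorials (m∣m*n (n !)))
    where
    k≤p : k ≤ suc n
    k≤p = m≤n⇒m≤1+n k≤n
    factorials : (suc n) ! ≡ (suc n C k) * (k ! * (suc n ∸ k) !)
    factorials = sym (trans (cong (_* (k ! * (suc n ∸ k) !)) (nCk≡n!/k![n-k]! k≤p))
      (m/n*n≡m {{k !* (suc n ∸ k) !≢0}} (k![n∸k]!∣n! k≤p)))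
  ... | inj₁ p∣C = p∣C
  ... | inj₂ p∣k![p-k]! with euclidsLemma (k !) ((suc n ∸ k) !) pr p∣k![p-k]!
  ...   | inj₁ p∣k! = contradiction p∣k! (prime∤! pr k (s≤s k≤n))
  ...   | inj₂ p∣[p-k]! = contradiction p∣[p-k]! (prime∤! pr (suc n ∸ k) (∸-monoʳ-< 0<k (m≤n⇒m≤1+n k≤n)))

  ^′≡^ : ∀ x n → x ^′ n ≡ x ^ n
  ^′≡^ x zero = refl
  ^′≡^ x (suc n) = cong (x *_) (^′≡^ x n)

  ×′≡* : ∀ n x → n ×′ x ≡ n * x
  ×′≡* zero x = refl
  ×′≡* (suc n) x = cong (_+_ x) (×′≡* n x)

  ∣-sum : ∀ {p n} (t : Vector ℕ n) → (∀ i → p ∣ t i) → p ∣ sum t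
  ∣-sum {n = zero} t p∣t = _ ∣0
  ∣-sum {n = suc n} t p∣t = ∣m∣n⇒∣m+n (p∣t zero) (∣-sum (tail t) (λ i → p∣t (suc i)))

  freshman : ∀ {p} → Prime p → ∀ a → ∃[ S ] (p ∣ S × suc a ^ p ≡ a ^ p + S + 1)
  freshman {zero} pr a = contradiction refl (≢-nonZero⁻¹ 0 {{prime⇒nonZero pr}})
  freshman {p@(suc n)} pr a = sum (init (tail t)) , ∣-sum (init (tail t)) p∣t , (begin
    suc a ^ p                                    ≡⟨ ^′≡^ (suc a) p ⟨
    (1 + a) ^′ p                                 ≡⟨ binomialTheorem p 1 a ⟩
    sum t                                        ≡⟨⟩
    t zero + sum (tail t)                        ≡⟨ cong (_+_ (t zero)) (sum-init-last +-0-monoid (tail t)) ⟩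
    t zero + (sum (init (tail t)) + last (tail t)) ≡⟨ cong₂ (λ x y → x + (sum (init (tail t)) + y)) first final ⟩
    a ^ p + (sum (init (tail t)) + 1)            ≡⟨ +-assoc (a ^ p) _ 1 ⟨
    a ^ p + sum (init (tail t)) + 1              ∎)
    where
    open ≡-Reasoning
    -- Term k is C(p,k)·1^k·a^(p-k). The first term is a^p, the last is 1, and `init (tail t)` holds
    -- the terms with 0 < k < p.
    t : Vector ℕ (suc p)
    t = binomialTerm 1 a p
    p∣t : ∀ i → p ∣ init (tail t) i
    p∣t i = subst (p ∣_) (sym (×′≡* (p C toℕ (suc (inject₁ i))) _))
      (∣m⇒∣m*n _ (prime∣C pr z<s (subst (_≤ n) (cong suc (sym (toℕ-inject₁ i))) (toℕ<n i))))
    first : t zero ≡ a ^ p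
    first = trans (+-identityʳ _) (trans (*-identityˡ (a ^′ p)) (^′≡^ a p))
    final : last (tail t) ≡ 1
    final rewrite toℕ-fromℕ n | nCn≡1 p | n∸n≡0 n = trans (+-identityʳ _) (trans (*-identityʳ (1 ^′ p)) (trans (^′≡^ 1 p) (^-zeroˡ p)))

  fermat : ∀ {p} → Prime p → ∀ a → + p ∣ℤ + (a ^ p) ℤ.- + a
  fermat {p} pr zero = subst (λ x → + p ∣ℤ + x ℤ.- + 0) (sym (0^ p (prime⇒nonZero pr))) (divides (+ 0) refl)
    where
    0^ : ∀ p → NonZero p → 0 ^ p ≡ 0
    0^ (suc _) _ = refl
  fermat {p} pr (suc a) with S , p∣S , eq ← freshman pr a =
    subst (+ p ∣ℤ_) (sym (trans (cong (λ x → + x ℤ.- + suc a) eq) (regroup (+ (a ^ p)) (+ S) (+ a))))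
      (∣m∣n⇒∣m+n-ℤ (fermat pr a) (∣ᵤ⇒∣ p∣S))
    where
    open ℤ∣ using () renaming (∣m∣n⇒∣m+n to ∣m∣n⇒∣m+n-ℤ)
    regroup : ∀ x s a → x ℤ.+ s ℤ.+ + 1 ℤ.- (+ 1 ℤ.+ a) ≡ x ℤ.- a ℤ.+ s
    regroup = IntSolver.solve-∀

  a-b∣aᵏ-bᵏ : ∀ {p} a b → + p ∣ℤ + a ℤ.- + b → ∀ k → + p ∣ℤ + (a ^ k) ℤ.- + (b ^ k)
  a-b∣aᵏ-bᵏ a b p∣ zero = divides (+ 0) refl
  a-b∣aᵏ-bᵏ {p} a b p∣ (suc k) = subst (+ p ∣ℤ_)
    (trans (telescope (+ a) (+ b) (+ (a ^ k)) (+ (b ^ k))) (cong₂ ℤ._-_ (sym (ℤₚ.pos-* a (a ^ k))) (sym (ℤₚ.pos-* b (b ^ k)))))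
    (ℤ∣.∣m∣n⇒∣m+n (ℤ∣.∣n⇒∣m*n (+ a) (a-b∣aᵏ-bᵏ a b p∣ k)) (ℤ∣.∣n⇒∣m*n (+ (b ^ k)) p∣))
    where
    telescope : ∀ a b x y → a ℤ.* (x ℤ.- y) ℤ.+ y ℤ.* (a ℤ.- b) ≡ a ℤ.* x ℤ.- b ℤ.* y
    telescope = IntSolver.solve-∀

  -- Write p = 3k + 2 and u = x^(3k), v = y^(3k). Fermat gives x²u ≡ x and y²v ≡ y. The form divides
  -- x³ - y³, so x³ ≡ y³ and u ≡ v; thus the single number u acts as an inverse of both x and y, and
  -- no division modulo p is needed.
  prime∣x²+xy+y²⇒∣x×∣y : ∀ {p} → Prime p → p % 3 ≡ 2 → ∀ x y → p ∣ x * x + x * y + y * y → p ∣ x × p ∣ y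
  prime∣x²+xy+y²⇒∣x×∣y {p} pr p≡2 x y p∣ = conclude (euclidsLemma 3 (x * y) pr p∣3xy)
    where
    k = p / 3
    u = (x * x * x) ^ k
    v = (y * y * y) ^ k
    X = + x
    Y = + y
    U = + u
    V = + v

    infixl 6 _+ᵈ_ _-ᵈ_
    infixr 7 _*ᵈ_
    _+ᵈ_ : ∀ {m n} → + p ∣ℤ m → + p ∣ℤ n → + p ∣ℤ m ⊕ n
    _+ᵈ_ = ℤ∣.∣m∣n⇒∣m+n
    _-ᵈ_ : ∀ {m n} → + p ∣ℤ m → + p ∣ℤ n → + p ∣ℤ m ⊖ n
    _-ᵈ_ = ℤ∣.∣m∣n⇒∣m-n
    _*ᵈ_ : ∀ m {n} → + p ∣ℤ n → + p ∣ℤ m ⊗ n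
    _*ᵈ_ = ℤ∣.∣n⇒∣m*n

    power : ∀ z → z ^ p ≡ z * z * (z * z * z) ^ k
    power z = begin
      z ^ p                     ≡⟨ cong (z ^_) (trans (m≡m%n+[m/n]*n p 3) (cong₂ _+_ p≡2 (*-comm k 3))) ⟩
      z ^ (2 + 3 * k)           ≡⟨ ^-distribˡ-+-* z 2 (3 * k) ⟩
      z ^ 2 * z ^ (3 * k)       ≡⟨ cong₂ _*_ (square z) (trans (sym (^-*-assoc z 3 k)) (cong (_^ k) (cube z))) ⟩
      z * z * (z * z * z) ^ k   ∎
      where
      open ≡-Reasoning
      square : ∀ z → z * (z * 1) ≡ z * z
      square = solve-∀
      cube : ∀ z → z * (z * (z * 1)) ≡ z * z * z
      cube = solve-∀

    pos-square : ∀ z w → + (z * z * w) ≡ + z ⊗ + z ⊗ + w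
    pos-square z w = trans (ℤₚ.pos-* (z * z) w) (cong (_⊗ + w) (ℤₚ.pos-* z z))

    reduced : ∀ z → + p ∣ℤ + z ⊗ + z ⊗ + ((z * z * z) ^ k) ⊖ + z
    reduced z = subst (λ w → + p ∣ℤ w ⊖ + z) (trans (cong +_ (power z)) (pos-square z _)) (fermat pr z)

    D₀ : + p ∣ℤ X ⊗ X ⊕ X ⊗ Y ⊕ Y ⊗ Y
    D₀ = subst (+ p ∣ℤ_) (cong₂ _⊕_ (cong₂ _⊕_ (ℤₚ.pos-* x x) (ℤₚ.pos-* x y)) (ℤₚ.pos-* y y)) (∣ᵤ⇒∣ p∣)

    D₁ : + p ∣ℤ X ⊗ X ⊗ U ⊖ X
    D₁ = reduced x

    U-V : + p ∣ℤ U ⊖ V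
    U-V = a-b∣aᵏ-bᵏ (x * x * x) (y * y * y)
      (subst (+ p ∣ℤ_) (trans (cubes X Y) (cong₂ _⊖_ (sym (pos-square x x)) (sym (pos-square y y)))) ((X ⊖ Y) *ᵈ D₀)) k
      where
      cubes : ∀ X Y → (X ⊖ Y) ⊗ (X ⊗ X ⊕ X ⊗ Y ⊕ Y ⊗ Y) ≡ X ⊗ X ⊗ X ⊖ Y ⊗ Y ⊗ Y
      cubes = IntSolver.solve-∀

    D₂ : + p ∣ℤ Y ⊗ Y ⊗ U ⊖ Y
    D₂ = subst (+ p ∣ℤ_) (combine Y U V) (reduced y +ᵈ (Y ⊗ Y) *ᵈ U-V)
      where
      combine : ∀ Y U V → Y ⊗ Y ⊗ V ⊖ Y ⊕ Y ⊗ Y ⊗ (U ⊖ V) ≡ Y ⊗ Y ⊗ U ⊖ Y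
      combine = IntSolver.solve-∀

    -- The form multiplied by u, with x²u and y²u reduced to x and y.
    E : + p ∣ℤ X ⊕ U ⊗ X ⊗ Y ⊕ Y
    E = subst (+ p ∣ℤ_) (combine X Y U) (U *ᵈ D₀ -ᵈ D₁ -ᵈ D₂)
      where
      combine : ∀ X Y U → U ⊗ (X ⊗ X ⊕ X ⊗ Y ⊕ Y ⊗ Y) ⊖ (X ⊗ X ⊗ U ⊖ X) ⊖ (Y ⊗ Y ⊗ U ⊖ Y) ≡ X ⊕ U ⊗ X ⊗ Y ⊕ Y
      combine = IntSolver.solve-∀

    -- Multiplying `E` by x produces ux²y, which reduces to xy; `G` is the same with x and y
    -- exchanged. The sum of `F` and `G` minus the form is 3xy, and once p divides xy they leave x²
    -- and y².
    F : + p ∣ℤ X ⊗ X ⊕ + 2 ⊗ (X ⊗ Y)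
    F = subst (+ p ∣ℤ_) (combine X Y U) (X *ᵈ E -ᵈ Y *ᵈ D₁)
      where
      combine : ∀ X Y U → X ⊗ (X ⊕ U ⊗ X ⊗ Y ⊕ Y) ⊖ Y ⊗ (X ⊗ X ⊗ U ⊖ X) ≡ X ⊗ X ⊕ + 2 ⊗ (X ⊗ Y)
      combine = IntSolver.solve-∀

    G : + p ∣ℤ Y ⊗ Y ⊕ + 2 ⊗ (X ⊗ Y)
    G = subst (+ p ∣ℤ_) (combine X Y U) (Y *ᵈ E -ᵈ X *ᵈ D₂)
      where
      combine : ∀ X Y U → Y ⊗ (X ⊕ U ⊗ X ⊗ Y ⊕ Y) ⊖ X ⊗ (Y ⊗ Y ⊗ U ⊖ Y) ≡ Y ⊗ Y ⊕ + 2 ⊗ (X ⊗ Y)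
      combine = IntSolver.solve-∀

    p∣3xy : p ∣ 3 * (x * y)
    p∣3xy = ∣⇒∣ᵤ (subst (+ p ∣ℤ_) (trans (combine X Y) (sym (trans (ℤₚ.pos-* 3 (x * y)) (cong (+ 3 ⊗_) (ℤₚ.pos-* x y))))) (F +ᵈ G -ᵈ D₀))
      where
      combine : ∀ X Y → X ⊗ X ⊕ + 2 ⊗ (X ⊗ Y) ⊕ (Y ⊗ Y ⊕ + 2 ⊗ (X ⊗ Y)) ⊖ (X ⊗ X ⊕ X ⊗ Y ⊕ Y ⊗ Y) ≡ + 3 ⊗ (X ⊗ Y)
      combine = IntSolver.solve-∀

    p∤3 : ¬ (p ∣ 3)
    p∤3 p∣3 = small p p≡2 (∣⇒≤ p∣3) p∣3
      where
      small : ∀ p → p % 3 ≡ 2 → p ≤ 3 → ¬ (p ∣ 3)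
      small 0 () _
      small 1 () _
      small 2 _ _ (divides-ℕ 0 ())
      small 2 _ _ (divides-ℕ 1 ())
      small 2 _ _ (divides-ℕ (suc (suc _)) ())
      small 3 () _
      small (suc (suc (suc (suc _)))) _ (s≤s (s≤s (s≤s ())))

    root : ∀ z → p ∣ z * z → p ∣ z
    root z p∣z² = [ (λ d → d) , (λ d → d) ]′ (euclidsLemma z z pr p∣z²)

    conclude : p ∣ 3 ⊎ p ∣ x * y → p ∣ x × p ∣ y
    conclude (inj₁ p∣3) = contradiction p∣3 p∤3
    conclude (inj₂ p∣xy) = root x (square x F) , root y (square y G)
      where
      2XY : + p ∣ℤ + 2 ⊗ (X ⊗ Y)
      2XY = (+ 2) *ᵈ subst (+ p ∣ℤ_) (ℤₚ.pos-* x y) (∣ᵤ⇒∣ p∣xy)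
      square : ∀ z → + p ∣ℤ + z ⊗ + z ⊕ + 2 ⊗ (X ⊗ Y) → p ∣ z * z
      square z d = ∣⇒∣ᵤ (subst (+ p ∣ℤ_) (trans (cancel (+ z ⊗ + z) (+ 2 ⊗ (X ⊗ Y))) (sym (ℤₚ.pos-* z z))) (d -ᵈ 2XY))
        where
        cancel : ∀ a b → a ⊕ b ⊖ b ≡ a
        cancel = IntSolver.solve-∀

  -- Infinite descent on k. The odd prime p divides s, hence the form, hence x and y, so p² divides
  -- the right side. As s is square-free, p divides s only once and must divide k; then k, x and y
  -- can all be divided by p.
  squareFree-obstruction : ∀ {p s} → Prime p → Odd p → p % 3 ≡ 2 → SquareFree s → p ∣ s →
    ∀ k → 0 < k → ∀ x y → s * (k * k) ≢ 2 * (x * x + x * y + y * y)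
  squareFree-obstruction {p} {s} pr p-odd p≡2 sf p∣s@(divides-ℕ s′ refl) = <-rec _ step
    where
    instance
      p≢0 : NonZero p
      p≢0 = prime⇒nonZero pr
    p∤2 : ¬ (p ∣ 2)
    p∤2 p∣2 = small p p-odd p≡2 (∣⇒≤ p∣2)
      where
      small : ∀ p → Odd p → p % 3 ≡ 2 → p ≤ 2 → ⊥
      small 0 () _ _
      small 1 _ () _
      small 2 () _ _
      small (suc (suc (suc _))) _ _ (s≤s (s≤s ()))
    step : ∀ k → (∀ {k′} → k′ < k → 0 < k′ → ∀ x y → s * (k′ * k′) ≢ 2 * (x * x + x * y + y * y)) →
           0 < k → ∀ x y → s * (k * k) ≢ 2 * (x * x + x * y + y * y)
    step k rec 0<k x y eq =
        [ p∤2 , (λ p∣form → descend (prime∣x²+xy+y²⇒∣x×∣y pr p≡2 x y p∣form) eq) ]′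
          (euclidsLemma 2 (x * x + x * y + y * y) pr (subst (p ∣_) eq (∣m⇒∣m*n (k * k) p∣s)))
      where
      open ≡-Reasoning
      scale : ∀ p x y → 2 * (x * p * (x * p) + x * p * (y * p) + y * p * (y * p)) ≡ 2 * (x * x + x * y + y * y) * p * p
      scale = solve-∀
      swap : ∀ a b c → a * b * c ≡ a * c * b
      swap = solve-∀
      regroup : ∀ s p k → s * p * (k * k) * p ≡ s * (k * p * (k * p))
      regroup = solve-∀
      descend : p ∣ x × p ∣ y → s * (k * k) ≢ 2 * (x * x + x * y + y * y)
      descend (divides-ℕ x′ refl , divides-ℕ y′ refl) eq = p∣s′k² (euclidsLemma s′ (k * k) pr (divides-ℕ (2 * Q) s′k²))
        where
        Q = x′ * x′ + x′ * y′ + y′ * y′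
        s′k² : s′ * (k * k) ≡ 2 * Q * p
        s′k² = *-cancelʳ-≡ _ _ p (begin
          s′ * (k * k) * p ≡⟨ swap s′ (k * k) p ⟩
          s′ * p * (k * k) ≡⟨ eq ⟩
          _                ≡⟨ scale p x′ y′ ⟩
          2 * Q * p * p    ∎)
        p∣k⇒⊥ : ∀ {k} → (∀ {k′} → k′ < k → 0 < k′ → ∀ x y → s * (k′ * k′) ≢ 2 * (x * x + x * y + y * y)) →
                0 < k → s′ * (k * k) ≡ 2 * Q * p → ¬ (p ∣ k)
        p∣k⇒⊥ rec 0<k _ (divides-ℕ zero refl) = <-irrefl refl 0<k
        p∣k⇒⊥ rec _ s′k² (divides-ℕ k′@(suc _) refl) = rec (m<m*n k′ p (nonTrivial⇒n>1 p {{prime⇒nonTrivial pr}})) z<s x′ y′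
          (*-cancelʳ-≡ _ _ p (trans (regroup s′ p k′) s′k²))
        p∣s′k² : ¬ (p ∣ s′ ⊎ p ∣ k * k)
        p∣s′k² (inj₁ (divides-ℕ s″ refl)) = nonTrivial⇒≢1 {{prime⇒nonTrivial pr}} (sf p (divides-ℕ s″ (*-assoc s″ p p)))
        p∣s′k² (inj₂ p∣k²) = [ p∣k⇒⊥ rec 0<k s′k² , p∣k⇒⊥ rec 0<k s′k² ]′ (euclidsLemma k k pr p∣k²)

-- Decidability of closed walks, the least odd length, and an explicit odd walk.

module Walks where
  open import Data.Fin using (toℕ; fromℕ<)
  import Data.Fin.Properties as Finₚ
  open import Data.Integer as ℤ using (ℤ; +_; -[1+_]; 0ℤ; ∣_∣)
  import Data.Integer.Properties as ℤₚ
  import Data.Integer.Tactic.RingSolver as IntSolver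
  open import Data.Nat
  open import Data.Nat.DivMod using ([m+kn]%n≡m%n)
  open import Data.Nat.Induction using (<-rec)
  open import Data.Nat.Properties
  open import Data.Nat.Tactic.RingSolver using (solve-∀)
  open import Data.Product using (_×_; _,_; ∃; ∃-syntax)
  open import Data.Sum using (inj₁; inj₂)
  open import Data.Vec as Vec using (Vec; []; _∷_)
  import Data.Vec.Properties as Vecₚ
  open import Data.Vec.Relation.Unary.All as All using (All; []; _∷_)
  open import Relation.Binary.PropositionalEquality
  open import Relation.Nullary using (Dec; yes; no)
  open import Relation.Nullary.Decidable using (map′; _×-dec_; _⊎-dec_)
  open import Relation.Unary using (Decidable)
  open Squares

  -- Bounded search in a form that passes to vectors without listing them: it suffices that every
  -- witness of Q lies in the region B.
  Exhaustible : {A : Set} → (A → Set) → Set₁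
  Exhaustible {A} B = ∀ {Q : A → Set} → Decidable Q → (∀ {a} → Q a → B a) → Dec (∃ Q)

  bounded-exhaustible : ∀ r → Exhaustible (λ i → ∣ i ∣ ≤ r)
  bounded-exhaustible r {Q} Q? Q⇒≤r =
    map′ (λ { (i , inj₁ q) → _ , q ; (i , inj₂ q) → _ , q }) find
         (Finₚ.any? λ i → Q? (+ toℕ {suc r} i) ⊎-dec Q? (ℤ.- + toℕ i))
    where
    find : ∃ Q → _
    find (+ n , q) = fromℕ< (s≤s (Q⇒≤r q)) , inj₁ (subst (λ n → Q (+ n)) (sym (Finₚ.toℕ-fromℕ< _)) q)
    find (-[1+ n ] , q) = fromℕ< (s≤s (Q⇒≤r q)) , inj₂ (subst (λ n → Q (ℤ.- + n)) (sym (Finₚ.toℕ-fromℕ< (s≤s (Q⇒≤r q)))) q)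

  Vec-exhaustible : ∀ {A} {B : A → Set} → Exhaustible B → ∀ n → Exhaustible {Vec A n} (All B)
  Vec-exhaustible ex zero Q? _ = map′ ([] ,_) (λ { ([] , q) → q }) (Q? [])
  Vec-exhaustible ex (suc n) Q? Q⇒B =
    map′ (λ { (x , xs , q) → x ∷ xs , q }) (λ { (x ∷ xs , q) → x , xs , q })
      (ex (λ x → Vec-exhaustible ex n (λ xs → Q? (x ∷ xs)) (λ q → All.tail (Q⇒B q)))
          (λ { (_ , q) → All.head (Q⇒B q) }))

  normSq-bounds : ∀ {m} (v : Vec ℤ m) → ∃[ s ] (normSq v ≡ + s × All (λ i → ∣ i ∣ ≤ s) v)
  normSq-bounds [] = 0 , refl , []
  normSq-bounds (i ∷ v) with s , eq , bounds ← normSq-bounds v =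
    ∣ i ∣ * ∣ i ∣ + s , cong₂ ℤ._+_ (i*i≡+∣i∣*∣i∣ i) eq ,
    ≤-trans (n≤n*n ∣ i ∣) (m≤m+n _ s) ∷ All.map (λ ≤s → ≤-trans ≤s (m≤n+m s _)) bounds

  -- Every coordinate i of a vector of norm r satisfies ∣i∣ ≤ i² ≤ r, so the search over n vectors
  -- is finite.
  closedWalk? : ∀ m r n → Dec (ClosedWalk m r n)
  closedWalk? m r n = Vec-exhaustible (Vec-exhaustible (bounded-exhaustible r) m) n
    (λ vs → All.all? (λ v → normSq v ℤ.≟ + r) vs ×-dec Vecₚ.≡-dec ℤ._≟_ (vectorSum vs) (Vec.replicate m 0ℤ))
    (λ (norms , _) → All.map bounds norms)
    where
    bounds : ∀ {v} → normSq v ≡ + r → All (λ i → ∣ i ∣ ≤ r) v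
    bounds {v} eq with s , eq′ , bs ← normSq-bounds v with refl ← ℤₚ.+-injective (trans (sym eq′) eq) = bs

  leastWitness : ∀ {Q : ℕ → Set} → Decidable Q → ∀ n → Q n → ∃[ n ] (Q n × ∀ k → Q k → n ≤ k)
  leastWitness {Q} Q? = <-rec _ step
    where
    step : ∀ n → (∀ {k} → k < n → Q k → ∃[ n ] (Q n × ∀ k → Q k → n ≤ k)) → Q n → ∃[ n ] (Q n × ∀ k → Q k → n ≤ k)
    step n rec q with anyUpTo? Q? n
    ... | yes (k , k<n , q′) = rec k<n q′
    ... | no ¬smaller = n , q , λ k q′ → ≮⇒≥ λ k<n → ¬smaller (k , k<n , q′)

  oddClosedWalk⇒C : ∀ {m r n} → Odd n → ClosedWalk m r n → ∃[ c ] (C m [ r ]≔ c × Odd c × ClosedWalk m r c)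
  oddClosedWalk⇒C {m} {r} {n} odd walk
    with c , (odd′ , walk′) , min ← leastWitness (λ n → (n % 2 ≟ 1) ×-dec closedWalk? m r n) n (odd , walk)
    = c , least odd′ walk′ (λ k o w → min k (o , w)) , odd′ , walk′

  -- Closed walks generalised to an arbitrary endpoint, so that pieces can be concatenated and their
  -- endpoints added.
  WalkTo : (m r n : ℕ) → Vec ℤ m → Set
  WalkTo m r n s = ∃[ vs ] (All (λ v → normSq v ≡ + r) vs × vectorSum {m} {n} vs ≡ s)

  _++ʷ_ : ∀ {m r n n′ s s′} → WalkTo m r n s → WalkTo m r n′ s′ → WalkTo m r (n + n′) (Vec.zipWith ℤ._+_ s s′)
  _++ʷ_ {s′ = s′} ([] , [] , refl) (ws , norms , eq) = ws , norms , trans eq (sym (Vecₚ.zipWith-identityˡ ℤₚ.+-identityˡ s′))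
  _++ʷ_ {s′ = s′} (v ∷ vs , norm ∷ norms , refl) walk
    with us , norms′ , eq ← (vs , norms , refl) ++ʷ walk
    = v ∷ us , norm ∷ norms′ , trans (cong (Vec.zipWith ℤ._+_ v) eq) (sym (Vecₚ.zipWith-assoc ℤₚ.+-assoc v (vectorSum vs) s′))

  diagonal : ℤ → Vec ℤ 3
  diagonal i = i ∷ i ∷ i ∷ []

  repeat : ∀ {r n i} k → WalkTo 3 r n (diagonal i) → WalkTo 3 r (k * n) (diagonal (+ k ℤ.* i))
  repeat {i = i} zero _ = [] , [] , cong diagonal (sym (ℤₚ.*-zeroˡ i))
  repeat {r} {n} {i} (suc k) walk = subst (λ j → WalkTo 3 r (suc k * n) (diagonal j)) (sym (ℤₚ.suc-* (+ k) i)) (walk ++ʷ repeat k walk)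

  cyclicShifts : ∀ e a b {r} → e ℤ.* e ℤ.+ a ℤ.* a ℤ.+ b ℤ.* b ≡ + r → WalkTo 3 r 3 (diagonal (e ℤ.+ a ℤ.+ b))
  cyclicShifts e a b norm =
    (e ∷ a ∷ b ∷ []) ∷ (b ∷ e ∷ a ∷ []) ∷ (a ∷ b ∷ e ∷ []) ∷ [] ,
    trans (n₁ e a b) norm ∷ trans (n₂ e a b) norm ∷ trans (n₃ e a b) norm ∷ [] ,
    cong₂ _∷_ (s₁ e a b) (cong₂ _∷_ (s₂ e a b) (cong (_∷ []) (s₃ e a b)))
    where
    n₁ : ∀ e a b → e ℤ.* e ℤ.+ (a ℤ.* a ℤ.+ (b ℤ.* b ℤ.+ 0ℤ)) ≡ e ℤ.* e ℤ.+ a ℤ.* a ℤ.+ b ℤ.* b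
    n₁ = IntSolver.solve-∀
    n₂ : ∀ e a b → b ℤ.* b ℤ.+ (e ℤ.* e ℤ.+ (a ℤ.* a ℤ.+ 0ℤ)) ≡ e ℤ.* e ℤ.+ a ℤ.* a ℤ.+ b ℤ.* b
    n₂ = IntSolver.solve-∀
    n₃ : ∀ e a b → a ℤ.* a ℤ.+ (b ℤ.* b ℤ.+ (e ℤ.* e ℤ.+ 0ℤ)) ≡ e ℤ.* e ℤ.+ a ℤ.* a ℤ.+ b ℤ.* b
    n₃ = IntSolver.solve-∀
    s₁ : ∀ e a b → e ℤ.+ (b ℤ.+ (a ℤ.+ 0ℤ)) ≡ e ℤ.+ a ℤ.+ b
    s₁ = IntSolver.solve-∀
    s₂ : ∀ e a b → a ℤ.+ (e ℤ.+ (b ℤ.+ 0ℤ)) ≡ e ℤ.+ a ℤ.+ b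
    s₂ = IntSolver.solve-∀
    s₃ : ∀ e a b → b ℤ.+ (a ℤ.+ (e ℤ.+ 0ℤ)) ≡ e ℤ.+ a ℤ.+ b
    s₃ = IntSolver.solve-∀

  -- The shifts of (e, a, b), taken a times, end at a(e + a + b) on the diagonal. One block of
  -- shifts of (-a, e, b) and of (-a, -e, -b) contributes -2a, so h = (e + a + b)/2 blocks cancel
  -- it. The length 3a + 6h is odd because a is.
  oddClosedWalk : ∀ {t} e a b h → a % 2 ≡ 1 → e + a + b ≡ 2 * h → e * e + a * a + b * b ≡ t →
                  ∃[ n ] (Odd n × ClosedWalk 3 t n)
  oddClosedWalk {t} e a b h a-odd S≡2h norm =
    a * 3 + h * 6 , odd , subst (WalkTo 3 t (a * 3 + h * 6)) (cong diagonal cancel)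
      (repeat a (cyclicShifts (+ e) (+ a) (+ b) norm₁) ++ʷ
       repeat h (cyclicShifts (ℤ.- + a) (+ e) (+ b) norm₂ ++ʷ cyclicShifts (ℤ.- + a) (ℤ.- + e) (ℤ.- + b) norm₃))
    where
    odd : (a * 3 + h * 6) % 2 ≡ 1
    odd = trans (cong (_% 2) (regroup a h)) (trans ([m+kn]%n≡m%n a (a + 3 * h) 2) a-odd)
      where
      regroup : ∀ a h → a * 3 + h * 6 ≡ a + (a + 3 * h) * 2
      regroup = solve-∀
    norm₁ : + e ℤ.* + e ℤ.+ + a ℤ.* + a ℤ.+ + b ℤ.* + b ≡ + t
    norm₁ = trans (sym (cong₂ ℤ._+_ (cong₂ ℤ._+_ (ℤₚ.pos-* e e) (ℤₚ.pos-* a a)) (ℤₚ.pos-* b b))) (cong +_ norm)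
    norm₂ = trans (flip₂ (+ e) (+ a) (+ b)) norm₁
      where
      flip₂ : ∀ e a b → ℤ.- a ℤ.* ℤ.- a ℤ.+ e ℤ.* e ℤ.+ b ℤ.* b ≡ e ℤ.* e ℤ.+ a ℤ.* a ℤ.+ b ℤ.* b
      flip₂ = IntSolver.solve-∀
    norm₃ = trans (flip₃ (+ e) (+ a) (+ b)) norm₁
      where
      flip₃ : ∀ e a b → ℤ.- a ℤ.* ℤ.- a ℤ.+ ℤ.- e ℤ.* ℤ.- e ℤ.+ ℤ.- b ℤ.* ℤ.- b ≡ e ℤ.* e ℤ.+ a ℤ.* a ℤ.+ b ℤ.* b
      flip₃ = IntSolver.solve-∀
    cancel : + a ℤ.* (+ e ℤ.+ + a ℤ.+ + b)
             ℤ.+ + h ℤ.* ((ℤ.- + a ℤ.+ + e ℤ.+ + b) ℤ.+ (ℤ.- + a ℤ.+ ℤ.- + e ℤ.+ ℤ.- + b)) ≡ 0ℤ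
    cancel = trans (collect (+ e) (+ a) (+ b) (+ h)) (trans (cong (λ S → + a ℤ.* (S ℤ.- + 2 ℤ.* + h))
        (trans (cong +_ S≡2h) (ℤₚ.pos-* 2 h))) (vanish (+ a) (+ h)))
      where
      collect : ∀ e a b h → a ℤ.* (e ℤ.+ a ℤ.+ b) ℤ.+ h ℤ.* ((ℤ.- a ℤ.+ e ℤ.+ b) ℤ.+ (ℤ.- a ℤ.+ ℤ.- e ℤ.+ ℤ.- b))
        ≡ a ℤ.* (e ℤ.+ a ℤ.+ b ℤ.- + 2 ℤ.* h)
      collect = IntSolver.solve-∀
      vanish : ∀ a h → a ℤ.* (+ 2 ℤ.* h ℤ.- + 2 ℤ.* h) ≡ 0ℤ
      vanish = IntSolver.solve-∀

-- Sums of three squares up to order and sign.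

module Representations where
  open import Data.Integer as ℤ using (+_; ∣_∣)
  import Data.Integer.Properties as ℤₚ
  open import Data.List using (List; []; _∷_; length; filter; cartesianProduct; upTo)
  open import Data.List.Membership.Propositional using (_∈_)
  open import Data.List.Membership.Propositional.Properties using (∈-filter⁺; ∈-filter⁻; ∈-cartesianProduct⁺; ∈-upTo⁺)
  open import Data.List.Relation.Unary.Any using (here; there)
  open import Data.Nat
  open import Data.Nat.DivMod using ([m+kn]%n≡m%n; m≡m%n+[m/n]*n; m%n<n)
  open import Data.Nat.Properties
  open import Data.Nat.Tactic.RingSolver using (solve-∀)
  open import Data.Product using (_×_; _,_; proj₂; ∃-syntax)
  open import Data.Sum using (_⊎_; inj₁; inj₂)
  open import Relation.Binary.PropositionalEquality
  open import Relation.Nullary using (contradiction)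
  open Squares

  data Perm3 (a b c : ℕ) : ℕ → ℕ → ℕ → Set where
    abc : Perm3 a b c a b c
    acb : Perm3 a b c a c b
    bac : Perm3 a b c b a c
    bca : Perm3 a b c b c a
    cab : Perm3 a b c c a b
    cba : Perm3 a b c c b a

  swap₁₂ : ∀ {a b c x y z} → Perm3 a b c x y z → Perm3 b a c x y z
  swap₁₂ abc = bac
  swap₁₂ acb = bca
  swap₁₂ bac = abc
  swap₁₂ bca = acb
  swap₁₂ cab = cba
  swap₁₂ cba = cab

  swap₂₃ : ∀ {a b c x y z} → Perm3 a b c x y z → Perm3 a c b x y z
  swap₂₃ abc = acb
  swap₂₃ acb = abc
  swap₂₃ bac = cab
  swap₂₃ bca = cba
  swap₂₃ cab = bac
  swap₂₃ cba = bca

  Perm3-squares : ∀ {a b c x y z} → Perm3 a b c x y z → x * x + y * y + z * z ≡ a * a + b * b + c * c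
  Perm3-squares {a} {b} {c} = λ where
      abc → refl
      acb → p₁ a b c
      bac → p₂ a b c
      bca → p₃ a b c
      cab → p₄ a b c
      cba → p₅ a b c
    where
    p₁ : ∀ a b c → a * a + c * c + b * b ≡ a * a + b * b + c * c
    p₁ = solve-∀
    p₂ : ∀ a b c → b * b + a * a + c * c ≡ a * a + b * b + c * c
    p₂ = solve-∀
    p₃ : ∀ a b c → b * b + c * c + a * a ≡ a * a + b * b + c * c
    p₃ = solve-∀
    p₄ : ∀ a b c → c * c + a * a + b * b ≡ a * a + b * b + c * c
    p₄ = solve-∀
    p₅ : ∀ a b c → c * c + b * b + a * a ≡ a * a + b * b + c * c
    p₅ = solve-∀

  sort3 : ∀ x y z → ∃[ a ] ∃[ b ] ∃[ c ] (a ≤ b × b ≤ c × Perm3 a b c x y z)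
  sort3 x y z with ≤-total x y | ≤-total y z | ≤-total x z
  ... | inj₁ x≤y | inj₁ y≤z | _        = x , y , z , x≤y , y≤z , abc
  ... | inj₁ x≤y | inj₂ z≤y | inj₁ x≤z = x , z , y , x≤z , z≤y , acb
  ... | inj₁ x≤y | inj₂ z≤y | inj₂ z≤x = z , x , y , z≤x , x≤y , bca
  ... | inj₂ y≤x | inj₁ y≤z | inj₁ x≤z = y , x , z , y≤x , x≤z , bac
  ... | inj₂ y≤x | inj₁ y≤z | inj₂ z≤x = y , z , x , y≤z , z≤x , cab
  ... | inj₂ y≤x | inj₂ z≤y | _        = z , y , x , z≤y , y≤x , cba

  candidates : ℕ → List (ℕ × ℕ × ℕ)
  candidates z = cartesianProduct (upTo (suc z)) (cartesianProduct (upTo (suc z)) (upTo (suc z)))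

  orderedRep∈ : ∀ {z a b c} → OrderedRep z (a , b , c) → (a , b , c) ∈ filter (orderedRep? z) (candidates z)
  orderedRep∈ {z} {a} {b} {c} rep@(_ , _ , eq) = ∈-filter⁺ (orderedRep? z)
    (∈-cartesianProduct⁺ (bound a (≤-trans (m≤m+n _ _) (m≤m+n _ _)))
      (∈-cartesianProduct⁺ (bound b (≤-trans (m≤n+m _ (a * a)) (m≤m+n _ _))) (bound c (m≤n+m _ _)))) rep
    where
    bound : ∀ x → x * x ≤ a * a + b * b + c * c → x ∈ upTo (suc z)
    bound x x²≤ = ∈-upTo⁺ (s≤s (≤-trans (n≤n*n x) (subst (x * x ≤_) eq x²≤)))

  singleton : ∀ {A : Set} {xs : List A} → length xs ≡ 1 → ∃[ x ] (x ∈ xs × ∀ {y} → y ∈ xs → y ≡ x)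
  singleton {xs = x ∷ []} refl = x , here refl , λ { (here y≡x) → y≡x ; (there ()) }

  UniqueUpToPerm : (t a b c : ℕ) → Set
  UniqueUpToPerm t a b c = ∀ x y z → x ℤ.* x ℤ.+ y ℤ.* y ℤ.+ z ℤ.* z ≡ + t → Perm3 a b c (∣ x ∣) (∣ y ∣) (∣ z ∣)

  -- The sorted absolute values of any integer solution form an ordered representation, and
  -- therefore the only entry of the list that `P` counts.
  P≡1⇒unique : ∀ {t} → P t ≡ 1 → ∃[ a ] ∃[ b ] ∃[ c ] (a * a + b * b + c * c ≡ t × UniqueUpToPerm t a b c)
  P≡1⇒unique {t} P≡1 with (a , b , c) , abc∈ , unique ← singleton {xs = filter (orderedRep? t) (candidates t)} P≡1
    = a , b , c , proj₂ (proj₂ (proj₂ (∈-filter⁻ (orderedRep? t) {xs = candidates t} abc∈))) , perm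
    where
    perm : UniqueUpToPerm t a b c
    perm x y z norm with a′ , b′ , c′ , a≤b , b≤c , π ← sort3 (∣ x ∣) (∣ y ∣) (∣ z ∣)
      with refl ← unique (orderedRep∈ (a≤b , b≤c , trans (sym (Perm3-squares π)) (ℤₚ.+-injective
        (trans (sym (cong₂ ℤ._+_ (cong₂ ℤ._+_ (i*i≡+∣i∣*∣i∣ x) (i*i≡+∣i∣*∣i∣ y)) (i*i≡+∣i∣*∣i∣ z))) norm)))) = π

  n² : ∀ n → ∃[ k ] n * n ≡ n % 2 * (n % 2) + k * 4
  n² n = n / 2 * (n % 2) + n / 2 * (n / 2) , trans (cong (λ m → m * m) (m≡m%n+[m/n]*n n 2)) (expand (n % 2) (n / 2))
    where
    expand : ∀ r k → (r + k * 2) * (r + k * 2) ≡ r * r + (k * r + k * k) * 4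
    expand = solve-∀

  squares%4 : ∀ {t} a b c → a * a + b * b + c * c ≡ t →
    (a % 2 * (a % 2) + b % 2 * (b % 2) + c % 2 * (c % 2)) % 4 ≡ t % 4
  squares%4 a b c refl with i , eqa ← n² a | j , eqb ← n² b | k , eqc ← n² c =
    trans (sym ([m+kn]%n≡m%n (a % 2 * (a % 2) + b % 2 * (b % 2) + c % 2 * (c % 2)) (i + j + k) 4))
      (cong (_% 4) (trans (regroup (a % 2 * (a % 2)) (b % 2 * (b % 2)) (c % 2 * (c % 2)) i j k) (sym (cong₂ _+_ (cong₂ _+_ eqa eqb) eqc))))
    where
    regroup : ∀ x y z i j k → x + y + z + (i + j + k) * 4 ≡ x + i * 4 + (y + j * 4) + (z + k * 4)
    regroup = solve-∀

  n%2≡0∨1 : ∀ n → n % 2 ≡ 0 ⊎ n % 2 ≡ 1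
  n%2≡0∨1 n with n % 2 | m%n<n n 2
  ... | 0 | _ = inj₁ refl
  ... | 1 | _ = inj₂ refl
  ... | suc (suc _) | s≤s (s≤s ())

  EvenOddOdd : (t e a b : ℕ) → Set
  EvenOddOdd t e a b = e % 2 ≡ 0 × a % 2 ≡ 1 × b % 2 ≡ 1 × e * e + a * a + b * b ≡ t × UniqueUpToPerm t e a b

  -- Modulo 4 a sum of three squares is the number of its odd terms, so t ≡ 2 leaves exactly one
  -- even term, which is moved to the front.
  evenOddOdd : ∀ {t} → t % 4 ≡ 2 → P t ≡ 1 → ∃[ e ] ∃[ a ] ∃[ b ] EvenOddOdd t e a b
  evenOddOdd {t} t≡2 P≡1 with a , b , c , norm , unique ← P≡1⇒unique P≡1
    with a % 2 in pa | b % 2 in pb | c % 2 in pc | n%2≡0∨1 a | n%2≡0∨1 b | n%2≡0∨1 c | squares%4 a b c norm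
  ... | 0 | 1 | 1 | _ | _ | _ | _ = a , b , c , pa , pb , pc , norm , unique
  ... | 1 | 0 | 1 | _ | _ | _ | _ = b , a , c , pb , pa , pc , trans (Perm3-squares {a} {b} {c} bac) norm , λ x y z n → swap₁₂ (unique x y z n)
  ... | 1 | 1 | 0 | _ | _ | _ | _ = c , a , b , pc , pa , pb , trans (Perm3-squares {a} {b} {c} cab) norm , λ x y z n → swap₁₂ (swap₂₃ (unique x y z n))
  ... | 0 | 0 | 0 | _ | _ | _ | 0≡t = contradiction (trans 0≡t t≡2) λ ()
  ... | 0 | 0 | 1 | _ | _ | _ | 1≡t = contradiction (trans 1≡t t≡2) λ ()
  ... | 0 | 1 | 0 | _ | _ | _ | 1≡t = contradiction (trans 1≡t t≡2) λ ()
  ... | 1 | 0 | 0 | _ | _ | _ | 1≡t = contradiction (trans 1≡t t≡2) λ ()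
  ... | 1 | 1 | 1 | _ | _ | _ | 3≡t = contradiction (trans 3≡t t≡2) λ ()
  ... | suc (suc _) | _ | _ | inj₁ () | _ | _ | _
  ... | suc (suc _) | _ | _ | inj₂ () | _ | _ | _
  ... | _ | suc (suc _) | _ | _ | inj₁ () | _ | _
  ... | _ | suc (suc _) | _ | _ | inj₂ () | _ | _
  ... | _ | _ | suc (suc _) | _ | _ | inj₁ () | _
  ... | _ | _ | suc (suc _) | _ | _ | inj₂ () | _

-- Counting letters in the coordinates of a walk, and excluding short walks.

module Columns where
  open import Data.Empty using (⊥)
  open import Data.Integer as ℤ using (ℤ; +_; -[1+_]; 0ℤ; 1ℤ; -1ℤ; ∣_∣) renaming (_+_ to _⊕_; _*_ to _⊗_; _-_ to _⊖_)
  open import Data.Integer.Divisibility.Signed using (divides; ∣⇒∣ᵤ)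
  import Data.Integer.Properties as ℤₚ
  import Data.Integer.Tactic.RingSolver as IntSolver
  open import Data.Nat
  open import Data.Nat.DivMod using ([m+kn]%n≡m%n; m≡m%n+[m/n]*n)
  open import Data.Nat.Divisibility using () renaming (divides to divides-ℕ)
  open import Data.Nat.Properties
  open import Data.Nat.Tactic.RingSolver using (solve-∀)
  open import Data.Product using (_×_; _,_; proj₁; proj₂; ∃-syntax)
  open import Data.Sum using (_⊎_; inj₁; inj₂; [_,_]′)
  open import Data.Vec as Vec using (Vec; []; _∷_)
  open import Data.Vec.Relation.Unary.All using (All; []; _∷_)
  open import Relation.Binary.PropositionalEquality
  open import Relation.Nullary using (¬_; contradiction)
  open Representations

  -- The net coefficient of a letter that occurs n times in one coordinate, each time with its own
  -- sign.
  data SignedSum : ℕ → ℤ → Set where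
    none  : SignedSum 0 0ℤ
    plus  : ∀ {n i} → SignedSum n i → SignedSum (suc n) (1ℤ ⊕ i)
    minus : ∀ {n i} → SignedSum n i → SignedSum (suc n) (-1ℤ ⊕ i)

  signedSum-1 : ∀ {i} → SignedSum 1 i → ∣ i ∣ ≡ 1
  signedSum-1 (plus none) = refl
  signedSum-1 (minus none) = refl

  signedSum-3 : ∀ {i} → SignedSum 3 i → ∣ i ∣ ≡ 1 ⊎ ∣ i ∣ ≡ 3
  signedSum-3 (plus (plus (plus none))) = inj₂ refl
  signedSum-3 (plus (plus (minus none))) = inj₁ refl
  signedSum-3 (plus (minus (plus none))) = inj₁ refl
  signedSum-3 (plus (minus (minus none))) = inj₁ refl
  signedSum-3 (minus (plus (plus none))) = inj₁ refl
  signedSum-3 (minus (plus (minus none))) = inj₁ refl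
  signedSum-3 (minus (minus (plus none))) = inj₁ refl
  signedSum-3 (minus (minus (minus none))) = inj₂ refl

  signedSum-≤ : ∀ {n i} → SignedSum n i → ∣ i ∣ ≤ n
  signedSum-≤ none = z≤n
  signedSum-≤ (plus {i = i} s) = ≤-trans (ℤₚ.∣i+j∣≤∣i∣+∣j∣ 1ℤ i) (s≤s (signedSum-≤ s))
  signedSum-≤ (minus {i = i} s) = ≤-trans (ℤₚ.∣i+j∣≤∣i∣+∣j∣ -1ℤ i) (s≤s (signedSum-≤ s))

  -- The witness k counts the minus signs.
  signedSum-parity : ∀ {n i} → SignedSum n i → ∃[ k ] + n ≡ i ⊕ k ⊗ + 2
  signedSum-parity none = 0ℤ , refl
  signedSum-parity (plus {n} {i} s) with k , eq ← signedSum-parity s = k , trans (cong (1ℤ ⊕_) eq) (shift i k)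
    where
    shift : ∀ i k → 1ℤ ⊕ (i ⊕ k ⊗ + 2) ≡ 1ℤ ⊕ i ⊕ k ⊗ + 2
    shift = IntSolver.solve-∀
  signedSum-parity (minus {n} {i} s) with k , eq ← signedSum-parity s = k ⊕ 1ℤ , trans (cong (1ℤ ⊕_) eq) (shift i k)
    where
    shift : ∀ i k → 1ℤ ⊕ (i ⊕ k ⊗ + 2) ≡ -1ℤ ⊕ i ⊕ (k ⊕ 1ℤ) ⊗ + 2
    shift = IntSolver.solve-∀

  even-+ : ∀ {n} k → + n ≡ k ⊗ + 2 → n % 2 ≡ 0
  even-+ {n} k eq with ∣⇒∣ᵤ (divides k eq)
  ... | divides-ℕ q refl = [m+kn]%n≡m%n 0 q 2

  signedSum-odd≢0 : ∀ {n i} → Odd n → SignedSum n i → i ≢ 0ℤ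
  signedSum-odd≢0 odd s refl with k , eq ← signedSum-parity s = contradiction (trans (sym odd) (even-+ k (trans eq (ℤₚ.+-identityˡ _)))) λ ()

  ±∣_∣ : ∀ i → i ≡ + ∣ i ∣ ⊎ i ≡ ℤ.- + ∣ i ∣
  ±∣ + n ∣ = inj₁ refl
  ±∣ -[1+ n ] ∣ = inj₂ refl

  module Letters (e a b : ℕ) where

    Relation : ℤ → ℤ → ℤ → ℤ → Set
    Relation α β γ x = α ⊗ + e ⊕ β ⊗ + a ⊕ γ ⊗ + b ≡ x

    -- The bound 5 is the largest coefficient possible in a walk of length 5. Only the minors
    -- involving the coefficients of e are listed: where α is nonzero, as in every column with an
    -- odd count of e, these two already give proportionality.
    Proportional : Set
    Proportional = ∀ α β γ α′ β′ γ′ →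
      ∣ α ∣ ≤ 5 → ∣ β ∣ ≤ 5 → ∣ γ ∣ ≤ 5 → ∣ α′ ∣ ≤ 5 → ∣ β′ ∣ ≤ 5 → ∣ γ′ ∣ ≤ 5 →
      Relation α β γ 0ℤ → Relation α′ β′ γ′ 0ℤ → α ⊗ β′ ≡ β ⊗ α′ × α ⊗ γ′ ≡ γ ⊗ α′

    Column : ℕ → ℕ → ℕ → ℤ → Set
    Column nᵉ nᵃ nᵇ x = ∃[ α ] ∃[ β ] ∃[ γ ] (SignedSum nᵉ α × SignedSum nᵃ β × SignedSum nᵇ γ × Relation α β γ x)

    addᵉ : ∀ {nᵉ nᵃ nᵇ x} i → ∣ i ∣ ≡ e → Column nᵉ nᵃ nᵇ x → Column (suc nᵉ) nᵃ nᵇ (i ⊕ x)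
    addᵉ i refl (α , β , γ , sα , sβ , sγ , refl) with ±∣ i ∣
    ... | inj₁ eq = 1ℤ ⊕ α , β , γ , plus sα , sβ , sγ , trans (add (+ e) (+ a) (+ b) α β γ) (cong (_⊕ (α ⊗ + e ⊕ β ⊗ + a ⊕ γ ⊗ + b)) (sym eq))
      where
      add : ∀ e a b α β γ → (1ℤ ⊕ α) ⊗ e ⊕ β ⊗ a ⊕ γ ⊗ b ≡ e ⊕ (α ⊗ e ⊕ β ⊗ a ⊕ γ ⊗ b)
      add = IntSolver.solve-∀
    ... | inj₂ eq = -1ℤ ⊕ α , β , γ , minus sα , sβ , sγ , trans (add (+ e) (+ a) (+ b) α β γ) (cong (_⊕ (α ⊗ + e ⊕ β ⊗ + a ⊕ γ ⊗ + b)) (sym eq))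
      where
      add : ∀ e a b α β γ → (-1ℤ ⊕ α) ⊗ e ⊕ β ⊗ a ⊕ γ ⊗ b ≡ ℤ.- e ⊕ (α ⊗ e ⊕ β ⊗ a ⊕ γ ⊗ b)
      add = IntSolver.solve-∀

    addᵃ : ∀ {nᵉ nᵃ nᵇ x} i → ∣ i ∣ ≡ a → Column nᵉ nᵃ nᵇ x → Column nᵉ (suc nᵃ) nᵇ (i ⊕ x)
    addᵃ i refl (α , β , γ , sα , sβ , sγ , refl) with ±∣ i ∣
    ... | inj₁ eq = α , 1ℤ ⊕ β , γ , sα , plus sβ , sγ , trans (add (+ e) (+ a) (+ b) α β γ) (cong (_⊕ (α ⊗ + e ⊕ β ⊗ + a ⊕ γ ⊗ + b)) (sym eq))
      where
      add : ∀ e a b α β γ → α ⊗ e ⊕ (1ℤ ⊕ β) ⊗ a ⊕ γ ⊗ b ≡ a ⊕ (α ⊗ e ⊕ β ⊗ a ⊕ γ ⊗ b)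
      add = IntSolver.solve-∀
    ... | inj₂ eq = α , -1ℤ ⊕ β , γ , sα , minus sβ , sγ , trans (add (+ e) (+ a) (+ b) α β γ) (cong (_⊕ (α ⊗ + e ⊕ β ⊗ + a ⊕ γ ⊗ + b)) (sym eq))
      where
      add : ∀ e a b α β γ → α ⊗ e ⊕ (-1ℤ ⊕ β) ⊗ a ⊕ γ ⊗ b ≡ ℤ.- a ⊕ (α ⊗ e ⊕ β ⊗ a ⊕ γ ⊗ b)
      add = IntSolver.solve-∀

    addᵇ : ∀ {nᵉ nᵃ nᵇ x} i → ∣ i ∣ ≡ b → Column nᵉ nᵃ nᵇ x → Column nᵉ nᵃ (suc nᵇ) (i ⊕ x)
    addᵇ i refl (α , β , γ , sα , sβ , sγ , refl) with ±∣ i ∣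
    ... | inj₁ eq = α , β , 1ℤ ⊕ γ , sα , sβ , plus sγ , trans (add (+ e) (+ a) (+ b) α β γ) (cong (_⊕ (α ⊗ + e ⊕ β ⊗ + a ⊕ γ ⊗ + b)) (sym eq))
      where
      add : ∀ e a b α β γ → α ⊗ e ⊕ β ⊗ a ⊕ (1ℤ ⊕ γ) ⊗ b ≡ b ⊕ (α ⊗ e ⊕ β ⊗ a ⊕ γ ⊗ b)
      add = IntSolver.solve-∀
    ... | inj₂ eq = α , β , -1ℤ ⊕ γ , sα , sβ , minus sγ , trans (add (+ e) (+ a) (+ b) α β γ) (cong (_⊕ (α ⊗ + e ⊕ β ⊗ + a ⊕ γ ⊗ + b)) (sym eq))
      where
      add : ∀ e a b α β γ → α ⊗ e ⊕ β ⊗ a ⊕ (-1ℤ ⊕ γ) ⊗ b ≡ ℤ.- b ⊕ (α ⊗ e ⊕ β ⊗ a ⊕ γ ⊗ b)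
      add = IntSolver.solve-∀

    -- Each vector puts every letter into exactly one coordinate and one letter into every
    -- coordinate. Hence the 3 × 3 matrix of counts has all row and column sums n.
    record Tally (n : ℕ) (s : Vec ℤ 3) : Set where
      constructor tally
      field
        {e₁ e₂ e₃ a₁ a₂ a₃ b₁ b₂ b₃} : ℕ
        column₁ : Column e₁ a₁ b₁ (Vec.head s)
        column₂ : Column e₂ a₂ b₂ (Vec.head (Vec.tail s))
        column₃ : Column e₃ a₃ b₃ (Vec.head (Vec.tail (Vec.tail s)))
        Σe : e₁ + e₂ + e₃ ≡ n
        Σa : a₁ + a₂ + a₃ ≡ n
        Σb : b₁ + b₂ + b₃ ≡ n
        Σ₁ : e₁ + (a₁ + b₁) ≡ n
        Σ₂ : e₂ + (a₂ + b₂) ≡ n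
        Σ₃ : e₃ + (a₃ + b₃) ≡ n

    suc₂ : ∀ x {y z n} → x + y + z ≡ n → x + suc y + z ≡ suc n
    suc₂ x {y} {z} eq = trans (cong (_+ z) (+-suc x y)) (cong suc eq)

    suc₃ : ∀ x {y z n} → x + y + z ≡ n → x + y + suc z ≡ suc n
    suc₃ x {y} {z} eq = trans (+-suc (x + y) z) (cong suc eq)

    sucᵃ : ∀ x {m n} → x + m ≡ n → x + suc m ≡ suc n
    sucᵃ x {m} eq = trans (+-suc x m) (cong suc eq)

    sucᵇ : ∀ x y {z n} → x + (y + z) ≡ n → x + (y + suc z) ≡ suc n
    sucᵇ x y {z} eq = trans (cong (λ m → x + m) (+-suc y z)) (sucᵃ x eq)

    extend : ∀ {n x y z s} → Perm3 e a b (∣ x ∣) (∣ y ∣) (∣ z ∣) → Tally n s → Tally (suc n) (Vec.zipWith _⊕_ (x ∷ y ∷ z ∷ []) s)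
    extend {x = x} {y} {z} {x′ ∷ y′ ∷ z′ ∷ []} π (tally {e₁} {e₂} {e₃} {a₁} {a₂} {a₃} {b₁} {b₂} {b₃} c₁ c₂ c₃ Σe Σa Σb Σ₁ Σ₂ Σ₃)
      with ∣ x ∣ in x≡ | ∣ y ∣ in y≡ | ∣ z ∣ in z≡ | π
    ... | _ | _ | _ | abc = tally (addᵉ x x≡ c₁) (addᵃ y y≡ c₂) (addᵇ z z≡ c₃) (cong suc Σe) (suc₂ a₁ Σa) (suc₃ b₁ Σb) (cong suc Σ₁) (sucᵃ e₂ Σ₂) (sucᵇ e₃ a₃ Σ₃)
    ... | _ | _ | _ | acb = tally (addᵉ x x≡ c₁) (addᵇ y y≡ c₂) (addᵃ z z≡ c₃) (cong suc Σe) (suc₃ a₁ Σa) (suc₂ b₁ Σb) (cong suc Σ₁) (sucᵇ e₂ a₂ Σ₂) (sucᵃ e₃ Σ₃)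
    ... | _ | _ | _ | bac = tally (addᵃ x x≡ c₁) (addᵉ y y≡ c₂) (addᵇ z z≡ c₃) (suc₂ e₁ Σe) (cong suc Σa) (suc₃ b₁ Σb) (sucᵃ e₁ Σ₁) (cong suc Σ₂) (sucᵇ e₃ a₃ Σ₃)
    ... | _ | _ | _ | bca = tally (addᵃ x x≡ c₁) (addᵇ y y≡ c₂) (addᵉ z z≡ c₃) (suc₃ e₁ Σe) (cong suc Σa) (suc₂ b₁ Σb) (sucᵃ e₁ Σ₁) (sucᵇ e₂ a₂ Σ₂) (cong suc Σ₃)
    ... | _ | _ | _ | cab = tally (addᵇ x x≡ c₁) (addᵉ y y≡ c₂) (addᵃ z z≡ c₃) (suc₂ e₁ Σe) (suc₃ a₁ Σa) (cong suc Σb) (sucᵇ e₁ a₁ Σ₁) (cong suc Σ₂) (sucᵃ e₃ Σ₃)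
    ... | _ | _ | _ | cba = tally (addᵇ x x≡ c₁) (addᵃ y y≡ c₂) (addᵉ z z≡ c₃) (suc₃ e₁ Σe) (suc₂ a₁ Σa) (cong suc Σb) (sucᵇ e₁ a₁ Σ₁) (sucᵃ e₂ Σ₂) (cong suc Σ₃)

    walkTally : ∀ {t} → UniqueUpToPerm t e a b → ∀ {n} (vs : Vec (Vec ℤ 3) n) → All (λ v → normSq v ≡ + t) vs → Tally n (vectorSum vs)
    walkTally unique [] [] = tally empty empty empty refl refl refl refl refl refl
      where
      empty : Column 0 0 0 0ℤ
      empty = 0ℤ , 0ℤ , 0ℤ , none , none , none , refl
    walkTally unique ((x ∷ y ∷ z ∷ []) ∷ vs) (norm ∷ norms) =
      extend (unique x y z (trans (regroup x y z) norm)) (walkTally unique vs norms)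
      where
      regroup : ∀ x y z → x ⊗ x ⊕ y ⊗ y ⊕ z ⊗ z ≡ x ⊗ x ⊕ (y ⊗ y ⊕ (z ⊗ z ⊕ 0ℤ))
      regroup = IntSolver.solve-∀

  SumRelation : ℕ → ℕ → ℕ → Set
  SumRelation e a b = e ≡ a + b ⊎ a ≡ e + b ⊎ b ≡ e + a

  ∣i∣≡1⇒i≡±1 : ∀ i → ∣ i ∣ ≡ 1 → i ≡ 1ℤ ⊎ i ≡ -1ℤ
  ∣i∣≡1⇒i≡±1 (+ 1) refl = inj₁ refl
  ∣i∣≡1⇒i≡±1 -[1+ 0 ] refl = inj₂ refl

  i≡j+0⇒i≡j : ∀ {i j k} → i ≡ j ⊕ k → k ≡ 0ℤ → i ≡ j
  i≡j+0⇒i≡j {j = j} eq refl = trans eq (ℤₚ.+-identityʳ j)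

  i≡j-0⇒i≡j : ∀ {i j k} → i ≡ j ⊖ k → k ≡ 0ℤ → i ≡ j
  i≡j-0⇒i≡j {j = j} eq refl = trans eq (ℤₚ.+-identityʳ j)

  module ShortWalks (e a b : ℕ) (e-even : e % 2 ≡ 0) (a-odd : Odd a) (b-odd : Odd b) where
    open Letters e a b

    -- Modulo 2 the relation αe + βa + γb = 0 becomes β + γ ≡ 0, and β, γ have the parities of their
    -- numbers of signs.
    column-parity : ∀ {nᵉ nᵃ nᵇ} → Column nᵉ nᵃ nᵇ 0ℤ → (nᵃ + nᵇ) % 2 ≡ 0
    column-parity {nᵉ} {nᵃ} {nᵇ} (α , β , γ , _ , sβ , sγ , rel)
      with k , nᵃ≡ ← signedSum-parity sβ | l , nᵇ≡ ← signedSum-parity sγ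
      = even-+ (k ⊕ l ⊖ α ⊗ + (e / 2) ⊖ β ⊗ + (a / 2) ⊖ γ ⊗ + (b / 2)) (begin
        + (nᵃ + nᵇ)                                         ≡⟨ cong₂ _⊕_ nᵃ≡ nᵇ≡ ⟩
        (β ⊕ k ⊗ + 2) ⊕ (γ ⊕ l ⊗ + 2)                       ≡⟨ ℤₚ.+-identityʳ _ ⟨
        (β ⊕ k ⊗ + 2) ⊕ (γ ⊕ l ⊗ + 2) ⊖ 0ℤ                  ≡⟨ cong (λ r → (β ⊕ k ⊗ + 2) ⊕ (γ ⊕ l ⊗ + 2) ⊖ r) halved ⟨
        _                                                   ≡⟨ collect α β γ k l (+ (e / 2)) (+ (a / 2)) (+ (b / 2)) ⟩
        _                                                   ∎)
      where
      open ≡-Reasoning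
      quotient : ∀ x {r} → x % 2 ≡ r → + x ≡ + r ⊕ + (x / 2) ⊗ + 2
      quotient x refl = trans (cong +_ (m≡m%n+[m/n]*n x 2)) (cong (+ (x % 2) ⊕_) (ℤₚ.pos-* (x / 2) 2))
      halved : α ⊗ (0ℤ ⊕ + (e / 2) ⊗ + 2) ⊕ β ⊗ (1ℤ ⊕ + (a / 2) ⊗ + 2) ⊕ γ ⊗ (1ℤ ⊕ + (b / 2) ⊗ + 2) ≡ 0ℤ
      halved = trans (sym (cong₂ _⊕_ (cong₂ _⊕_ (cong (α ⊗_) (quotient e e-even)) (cong (β ⊗_) (quotient a a-odd))) (cong (γ ⊗_) (quotient b b-odd)))) rel
      collect : ∀ α β γ k l e a b →
        (β ⊕ k ⊗ + 2) ⊕ (γ ⊕ l ⊗ + 2) ⊖ (α ⊗ (0ℤ ⊕ e ⊗ + 2) ⊕ β ⊗ (1ℤ ⊕ a ⊗ + 2) ⊕ γ ⊗ (1ℤ ⊕ b ⊗ + 2))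
        ≡ (k ⊕ l ⊖ α ⊗ e ⊖ β ⊗ a ⊖ γ ⊗ b) ⊗ + 2
      collect = IntSolver.solve-∀

    column-odd : ∀ {n nᵉ nᵃ nᵇ} → Odd n → nᵉ + (nᵃ + nᵇ) ≡ n → Column nᵉ nᵃ nᵇ 0ℤ → ∃[ k ] nᵉ ≡ 1 + k * 2
    column-odd {n} {nᵉ} {nᵃ} {nᵇ} odd eq col = nᵉ / 2 , trans (m≡m%n+[m/n]*n nᵉ 2) (cong (_+ nᵉ / 2 * 2) (begin
      nᵉ % 2                            ≡⟨ [m+kn]%n≡m%n nᵉ ((nᵃ + nᵇ) / 2) 2 ⟨
      (nᵉ + (nᵃ + nᵇ) / 2 * 2) % 2      ≡⟨ cong (λ m → (nᵉ + m) % 2) halves ⟨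
      (nᵉ + (nᵃ + nᵇ)) % 2              ≡⟨ cong (_% 2) eq ⟩
      n % 2                             ≡⟨ odd ⟩
      1                                 ∎))
      where
      open ≡-Reasoning
      halves : nᵃ + nᵇ ≡ (nᵃ + nᵇ) / 2 * 2
      halves = trans (m≡m%n+[m/n]*n (nᵃ + nᵇ) 2) (cong (_+ (nᵃ + nᵇ) / 2 * 2) (column-parity col))

    -- Three equal signs would make the natural number a + e + b zero, against a odd. Otherwise one
    -- letter stands against the other two.
    unitRelation : ∀ α β γ → ∣ α ∣ ≡ 1 → ∣ β ∣ ≡ 1 → ∣ γ ∣ ≡ 1 → Relation α β γ 0ℤ → SumRelation e a b
    unitRelation α β γ ∣α∣ ∣β∣ ∣γ∣ rel with ∣i∣≡1⇒i≡±1 α ∣α∣ | ∣i∣≡1⇒i≡±1 β ∣β∣ | ∣i∣≡1⇒i≡±1 γ ∣γ∣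
    ... | inj₁ refl | inj₁ refl | inj₁ refl = contradiction (trans (sym a-odd) (cong (_% 2) a≡0)) λ ()
      where
      positive : ∀ e a b → 1ℤ ⊗ e ⊕ 1ℤ ⊗ a ⊕ 1ℤ ⊗ b ≡ a ⊕ (e ⊕ b)
      positive = IntSolver.solve-∀
      a≡0 : a ≡ 0
      a≡0 = m+n≡0⇒m≡0 a (ℤₚ.+-injective (trans (sym (positive (+ e) (+ a) (+ b))) rel))
    ... | inj₂ refl | inj₂ refl | inj₂ refl = contradiction (trans (sym a-odd) (cong (_% 2) a≡0)) λ ()
      where
      positive : ∀ e a b → a ⊕ (e ⊕ b) ≡ ℤ.- (-1ℤ ⊗ e ⊕ -1ℤ ⊗ a ⊕ -1ℤ ⊗ b)
      positive = IntSolver.solve-∀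
      a≡0 : a ≡ 0
      a≡0 = m+n≡0⇒m≡0 a (ℤₚ.+-injective (trans (positive (+ e) (+ a) (+ b)) (cong ℤ.-_ rel)))
    ... | inj₁ refl | inj₂ refl | inj₂ refl = inj₁ (ℤₚ.+-injective (i≡j+0⇒i≡j (identity (+ e) (+ a) (+ b)) rel))
      where
      identity : ∀ e a b → e ≡ a ⊕ b ⊕ (1ℤ ⊗ e ⊕ -1ℤ ⊗ a ⊕ -1ℤ ⊗ b)
      identity = IntSolver.solve-∀
    ... | inj₂ refl | inj₁ refl | inj₁ refl = inj₁ (ℤₚ.+-injective (i≡j-0⇒i≡j (identity (+ e) (+ a) (+ b)) rel))
      where
      identity : ∀ e a b → e ≡ a ⊕ b ⊖ (-1ℤ ⊗ e ⊕ 1ℤ ⊗ a ⊕ 1ℤ ⊗ b)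
      identity = IntSolver.solve-∀
    ... | inj₁ refl | inj₂ refl | inj₁ refl = inj₂ (inj₁ (ℤₚ.+-injective (i≡j-0⇒i≡j (identity (+ e) (+ a) (+ b)) rel)))
      where
      identity : ∀ e a b → a ≡ e ⊕ b ⊖ (1ℤ ⊗ e ⊕ -1ℤ ⊗ a ⊕ 1ℤ ⊗ b)
      identity = IntSolver.solve-∀
    ... | inj₂ refl | inj₁ refl | inj₂ refl = inj₂ (inj₁ (ℤₚ.+-injective (i≡j+0⇒i≡j (identity (+ e) (+ a) (+ b)) rel)))
      where
      identity : ∀ e a b → a ≡ e ⊕ b ⊕ (-1ℤ ⊗ e ⊕ 1ℤ ⊗ a ⊕ -1ℤ ⊗ b)
      identity = IntSolver.solve-∀
    ... | inj₁ refl | inj₁ refl | inj₂ refl = inj₂ (inj₂ (ℤₚ.+-injective (i≡j-0⇒i≡j (identity (+ e) (+ a) (+ b)) rel)))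
      where
      identity : ∀ e a b → b ≡ e ⊕ a ⊖ (1ℤ ⊗ e ⊕ 1ℤ ⊗ a ⊕ -1ℤ ⊗ b)
      identity = IntSolver.solve-∀
    ... | inj₂ refl | inj₂ refl | inj₁ refl = inj₂ (inj₂ (ℤₚ.+-injective (i≡j+0⇒i≡j (identity (+ e) (+ a) (+ b)) rel)))
      where
      identity : ∀ e a b → b ≡ e ⊕ a ⊕ (-1ℤ ⊗ e ⊕ -1ℤ ⊗ a ⊕ 1ℤ ⊗ b)
      identity = IntSolver.solve-∀

    module _ (noSum : ¬ SumRelation e a b) where

      column-111 : ¬ Column 1 1 1 0ℤ
      column-111 (α , β , γ , sα , sβ , sγ , rel) = noSum (unitRelation α β γ (signedSum-1 sα) (signedSum-1 sβ) (signedSum-1 sγ) rel)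

      -- With no column of type 1, 1, 1 every count of a is 0 or 2, and the even total cannot be 3.
      noTally-3 : ∀ {a₁ a₂ a₃ b₁ b₂ b₃} → Column 1 a₁ b₁ 0ℤ → Column 1 a₂ b₂ 0ℤ → Column 1 a₃ b₃ 0ℤ →
        a₁ + b₁ ≡ 2 → a₂ + b₂ ≡ 2 → a₃ + b₃ ≡ 2 → a₁ + a₂ + a₃ ≡ 3 → ⊥
      noTally-3 {1} c₁ _ _ refl _ _ _ = column-111 c₁
      noTally-3 {_} {1} _ c₂ _ _ refl _ _ = column-111 c₂
      noTally-3 {0} {0} _ _ _ refl refl () refl
      noTally-3 {0} {2} _ _ c₃ refl refl refl refl = column-111 c₃
      noTally-3 {2} {0} _ _ c₃ refl refl refl refl = column-111 c₃
      noTally-3 {2} {2} _ _ _ refl refl _ ()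
      noTally-3 {suc (suc (suc _))} _ _ _ () _ _ _
      noTally-3 {_} {suc (suc (suc _))} _ _ _ _ () _ _

      module _ (proportional : Proportional) where

        twoColumns : ∀ {nᵉ nᵃ nᵇ mᵉ mᵃ mᵇ} → nᵉ + (nᵃ + nᵇ) ≡ 5 → mᵉ + (mᵃ + mᵇ) ≡ 5 →
          ((α , β , γ , _) : Column nᵉ nᵃ nᵇ 0ℤ) ((α′ , β′ , γ′ , _) : Column mᵉ mᵃ mᵇ 0ℤ) →
          α ⊗ β′ ≡ β ⊗ α′ × α ⊗ γ′ ≡ γ ⊗ α′
        twoColumns {nᵉ} {nᵃ} {nᵇ} {mᵉ} {mᵃ} {mᵇ} Σn Σm (α , β , γ , sα , sβ , sγ , rel) (α′ , β′ , γ′ , sα′ , sβ′ , sγ′ , rel′) =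
          proportional α β γ α′ β′ γ′ (E nᵉ Σn sα) (A nᵉ Σn sβ) (B nᵉ Σn sγ) (E mᵉ Σm sα′) (A mᵉ Σm sβ′) (B mᵉ Σm sγ′) rel rel′
          where
          E : ∀ x {m i} → x + m ≡ 5 → SignedSum x i → ∣ i ∣ ≤ 5
          E x eq s = ≤-trans (signedSum-≤ s) (subst (x ≤_) eq (m≤m+n x _))
          A : ∀ x {y z i} → x + (y + z) ≡ 5 → SignedSum y i → ∣ i ∣ ≤ 5
          A x {y} {z} eq s = ≤-trans (signedSum-≤ s) (subst (y ≤_) eq (≤-trans (m≤m+n y z) (m≤n+m (y + z) x)))
          B : ∀ x {y z i} → x + (y + z) ≡ 5 → SignedSum z i → ∣ i ∣ ≤ 5
          B x {y} {z} eq s = ≤-trans (signedSum-≤ s) (subst (z ≤_) eq (≤-trans (m≤n+m z y) (m≤n+m (y + z) x)))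

        product≢0 : ∀ {i j k} → i ≢ 0ℤ → j ≢ 0ℤ → i ⊗ j ≢ 0ℤ ⊗ k
        product≢0 {i} i≢0 j≢0 eq = [ i≢0 , j≢0 ]′ (ℤₚ.i*j≡0⇒i≡0∨j≡0 i eq)

        -- Here γ = 0, so proportionality gives αγ′ = 0; but α and γ′ are sums of an odd number of
        -- signs and hence nonzero.
        column-3,2,0 : ∀ {mᵉ mᵃ mᵇ} → mᵉ + (mᵃ + mᵇ) ≡ 5 → Odd mᵇ → Column 3 2 0 0ℤ → Column mᵉ mᵃ mᵇ 0ℤ → ⊥
        column-3,2,0 Σm odd c@(α , β , γ , sα , _ , none , _) c′@(α′ , _ , γ′ , _ , _ , sγ′ , _) =
          product≢0 {k = α′} (signedSum-odd≢0 refl sα) (signedSum-odd≢0 odd sγ′) (proj₂ (twoColumns refl Σm c c′))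

        column-3,0,2 : ∀ {mᵉ mᵃ mᵇ} → mᵉ + (mᵃ + mᵇ) ≡ 5 → Odd mᵃ → Column 3 0 2 0ℤ → Column mᵉ mᵃ mᵇ 0ℤ → ⊥
        column-3,0,2 Σm odd c@(α , β , γ , sα , none , _ , _) c′@(α′ , β′ , _ , _ , sβ′ , _ , _) =
          product≢0 {k = α′} (signedSum-odd≢0 refl sα) (signedSum-odd≢0 odd sβ′) (proj₁ (twoColumns refl Σm c c′))

        -- If ∣α∣ = 1, the first relation is ±e ± a ± b = 0. If ∣α∣ = 3, then αβ′ = βα′ reads 3∣β′∣
        -- = 1 in absolute values.
        column-3,1,1 : ∀ {mᵃ mᵇ} → 1 + (mᵃ + mᵇ) ≡ 5 → Column 3 1 1 0ℤ → Column 1 mᵃ mᵇ 0ℤ → ⊥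
        column-3,1,1 Σm c@(α , β , γ , sα , sβ , sγ , rel) c′@(α′ , β′ , γ′ , sα′ , _ , _ , _) with signedSum-3 sα
        ... | inj₁ ∣α∣≡1 = noSum (unitRelation α β γ ∣α∣≡1 (signedSum-1 sβ) (signedSum-1 sγ) rel)
        ... | inj₂ ∣α∣≡3 = 3n≢1 (∣ β′ ∣) (trans (cong (_* ∣ β′ ∣) (sym ∣α∣≡3)) (trans (sym (ℤₚ.abs-* α β′))
            (trans (cong ∣_∣ (proj₁ (twoColumns refl Σm c c′))) (trans (ℤₚ.abs-* β α′) (cong₂ _*_ (signedSum-1 sβ) (signedSum-1 sα′))))))
          where
          3n≢1 : ∀ n → 3 * n ≢ 1
          3n≢1 (suc n) eq with () ← trans (sym (*-suc 3 n)) eq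

        odd-summand : ∀ x y → x + y ≡ 5 → Odd x ⊎ Odd y
        odd-summand 0 5 refl = inj₂ refl
        odd-summand 1 4 refl = inj₁ refl
        odd-summand 2 3 refl = inj₂ refl
        odd-summand 3 2 refl = inj₁ refl
        odd-summand 4 1 refl = inj₂ refl
        odd-summand 5 0 refl = inj₁ refl

        -- The column with three letters e has two others. If both are a, all five letters b lie in
        -- the remaining two columns, one of which then has an odd number of them; likewise with a
        -- and b exchanged.
        noTally-5 : ∀ {a₁ a₂ a₃ b₁ b₂ b₃} → Column 3 a₁ b₁ 0ℤ → Column 1 a₂ b₂ 0ℤ → Column 1 a₃ b₃ 0ℤ →
          3 + (a₁ + b₁) ≡ 5 → 1 + (a₂ + b₂) ≡ 5 → 1 + (a₃ + b₃) ≡ 5 → a₁ + a₂ + a₃ ≡ 5 → b₁ + b₂ + b₃ ≡ 5 → ⊥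
        noTally-5 {1} c₁ c₂ _ refl Σ₂ _ _ _ = column-3,1,1 Σ₂ c₁ c₂
        noTally-5 {2} {b₂ = b₂} {b₃} c₁ c₂ c₃ refl Σ₂ Σ₃ _ Σb =
          [ (λ odd → column-3,2,0 Σ₂ odd c₁ c₂) , (λ odd → column-3,2,0 Σ₃ odd c₁ c₃) ]′ (odd-summand b₂ b₃ Σb)
        noTally-5 {0} {a₂} {a₃} c₁ c₂ c₃ refl Σ₂ Σ₃ Σa _ =
          [ (λ odd → column-3,0,2 Σ₂ odd c₁ c₂) , (λ odd → column-3,0,2 Σ₃ odd c₁ c₃) ]′ (odd-summand a₂ a₃ Σa)
        noTally-5 {suc (suc (suc _))} _ _ _ () _ _ _ _

        noTally : ∀ {n} → Odd n → n ≤ 5 → ¬ Tally n (0ℤ ∷ 0ℤ ∷ 0ℤ ∷ [])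
        noTally {n} odd n≤5 (tally c₁ c₂ c₃ refl Σa Σb Σ₁ Σ₂ Σ₃)
          with k₁ , refl ← column-odd odd Σ₁ c₁ | k₂ , refl ← column-odd odd Σ₂ c₂ | k₃ , refl ← column-odd odd Σ₃ c₃
          = dispatch k₁ k₂ k₃ k≤1 c₁ c₂ c₃ Σa Σb Σ₁ Σ₂ Σ₃
          where
          collect : ∀ k₁ k₂ k₃ → 1 + k₁ * 2 + (1 + k₂ * 2) + (1 + k₃ * 2) ≡ 3 + (k₁ + k₂ + k₃) * 2
          collect = solve-∀
          -- The counts of e are 1 + 2kᵢ and add up to n ≤ 5. So all kᵢ vanish and n = 3, or a
          -- single one equals 1 and n = 5.
          k≤1 : k₁ + k₂ + k₃ ≤ 1
          k≤1 = *-cancelʳ-≤ (k₁ + k₂ + k₃) 1 2 (+-cancelˡ-≤ 3 _ _ (subst (_≤ 5) (collect k₁ k₂ k₃) n≤5))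
          reverse : ∀ x y z → z + y + x ≡ x + y + z
          reverse = solve-∀
          dispatch : ∀ k₁ k₂ k₃ → k₁ + k₂ + k₃ ≤ 1 → ∀ {a₁ a₂ a₃ b₁ b₂ b₃} →
            let n = 1 + k₁ * 2 + (1 + k₂ * 2) + (1 + k₃ * 2) in
            Column (1 + k₁ * 2) a₁ b₁ 0ℤ → Column (1 + k₂ * 2) a₂ b₂ 0ℤ → Column (1 + k₃ * 2) a₃ b₃ 0ℤ →
            a₁ + a₂ + a₃ ≡ n → b₁ + b₂ + b₃ ≡ n →
            1 + k₁ * 2 + (a₁ + b₁) ≡ n → 1 + k₂ * 2 + (a₂ + b₂) ≡ n → 1 + k₃ * 2 + (a₃ + b₃) ≡ n → ⊥
          dispatch 0 0 0 _ c₁ c₂ c₃ Σa Σb Σ₁ Σ₂ Σ₃ =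
            noTally-3 c₁ c₂ c₃ (suc-injective Σ₁) (suc-injective Σ₂) (suc-injective Σ₃) Σa
          dispatch 1 0 0 _ c₁ c₂ c₃ Σa Σb Σ₁ Σ₂ Σ₃ = noTally-5 c₁ c₂ c₃ Σ₁ Σ₂ Σ₃ Σa Σb
          dispatch 0 1 0 _ {a₁} {a₂} {a₃} {b₁} {b₂} {b₃} c₁ c₂ c₃ Σa Σb Σ₁ Σ₂ Σ₃ = noTally-5 c₂ c₁ c₃ Σ₂ Σ₁ Σ₃
            (trans (cong (_+ a₃) (+-comm a₂ a₁)) Σa) (trans (cong (_+ b₃) (+-comm b₂ b₁)) Σb)
          dispatch 0 0 1 _ {a₁} {a₂} {a₃} {b₁} {b₂} {b₃} c₁ c₂ c₃ Σa Σb Σ₁ Σ₂ Σ₃ = noTally-5 c₃ c₂ c₁ Σ₃ Σ₂ Σ₁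
            (trans (reverse a₁ a₂ a₃) Σa) (trans (reverse b₁ b₂ b₃) Σb)
          dispatch 0 0 (suc (suc _)) (s≤s ())
          dispatch 0 1 (suc _) (s≤s ())
          dispatch 0 (suc (suc _)) _ (s≤s ())
          dispatch 1 0 (suc _) (s≤s ())
          dispatch 1 (suc _) _ (s≤s ())
          dispatch (suc (suc _)) _ _ (s≤s ())

-- Two independent small relations contradict t ≥ 10⁶.

module SmallRelations where
  open import Data.Empty using (⊥; ⊥-elim)
  open import Data.Integer as ℤ using (ℤ; +_; 0ℤ; ∣_∣) renaming (_+_ to _⊕_; _*_ to _⊗_; _-_ to _⊖_)
  import Data.Integer.Properties as ℤₚ
  import Data.Integer.Tactic.RingSolver as IntSolver
  open import Data.List using ([]; _∷_)
  open import Data.List.Relation.Unary.All using (_∷_)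
  open import Data.Nat
  open import Data.Nat.DivMod using ([m+kn]%n≡m%n; m≡m%n+[m/n]*n)
  open import Data.Nat.Divisibility using (_∣_; divides; ∣-trans; ∣⇒≤; ∣1⇒≡1; m∣m*n; *-cancelʳ-∣; *-monoˡ-∣; _∣?_)
  open import Data.Nat.GCD using (gcd; gcd[m,n]∣m; gcd[m,n]∣n; gcd-greatest; c*gcd[m,n]≡gcd[cm,cn])
  open import Data.Nat.ListAction using (product)
  open import Data.Nat.Primality using (Prime; prime⇒nonTrivial)
  open import Data.Nat.Primality.Factorisation using (factorise)
  open import Data.Nat.Properties
  open import Data.Nat.Tactic.RingSolver using (solve-∀)
  open import Data.Product using (_×_; _,_; proj₁; proj₂; ∃-syntax)
  open import Data.Sum using (_⊎_; inj₁; inj₂; [_,_]′)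
  open import Relation.Binary.PropositionalEquality
  open import Relation.Nullary using (¬_; contradiction)
  open import Relation.Nullary.Decidable using (toSum; decidable-stable)
  open FourSquares using (secondRep)
  open Representations
  open Columns using (module Letters)

  primeDivisor : ∀ g → 1 < g → ∃[ q ] (Prime q × q ∣ g)
  primeDivisor g@(suc _) 1<g with factorise g
  ... | record { factors = [] ; isFactorisation = g≡1 } = contradiction (sym g≡1) (<⇒≢ 1<g)
  ... | record { factors = q ∷ qs ; isFactorisation = g≡ ; factorsPrime = pr ∷ _ } = q , pr , subst (q ∣_) (sym g≡) (m∣m*n (product qs))

  Coprime3 : ℕ → ℕ → ℕ → Set
  Coprime3 x y z = ∀ {d} → d ∣ x → d ∣ y → d ∣ z → d ≡ 1

  coprime3⇒gcd≡1 : ∀ {x y z} → Coprime3 x y z → gcd x (gcd y z) ≡ 1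
  coprime3⇒gcd≡1 {x} {y} {z} cop = cop (gcd[m,n]∣m x (gcd y z))
    (∣-trans (gcd[m,n]∣n x (gcd y z)) (gcd[m,n]∣m y z)) (∣-trans (gcd[m,n]∣n x (gcd y z)) (gcd[m,n]∣n y z))

  commonFactor : ∀ e a b → a ≢ 0 → ∃[ g ] ∃[ x ] ∃[ y ] ∃[ z ] (e ≡ x * g × a ≡ y * g × b ≡ z * g × Coprime3 x y z)
  commonFactor e a b a≢0
    with divides x e≡ ← gcd[m,n]∣m e (gcd a b)
       | divides y a≡ ← ∣-trans (gcd[m,n]∣n e (gcd a b)) (gcd[m,n]∣m a b)
       | divides z b≡ ← ∣-trans (gcd[m,n]∣n e (gcd a b)) (gcd[m,n]∣n a b)
    = g , x , y , z , e≡ , a≡ , b≡ , coprime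
    where
    g = gcd e (gcd a b)
    g≢0 : g ≢ 0
    g≢0 g≡0 = a≢0 (trans a≡ (trans (cong (y *_) g≡0) (*-zeroʳ y)))
    scaled : ∀ {d m n} → n ≡ m * g → d ∣ m → d * g ∣ n
    scaled eq d∣m = subst (_ ∣_) (sym eq) (*-monoˡ-∣ g d∣m)
    coprime : Coprime3 x y z
    coprime {d} d∣x d∣y d∣z = ∣1⇒≡1 (*-cancelʳ-∣ g {{≢-nonZero g≢0}} (subst (d * g ∣_) (sym (*-identityˡ g))
      (gcd-greatest (scaled e≡ d∣x) (gcd-greatest (scaled a≡ d∣y) (scaled b≡ d∣z)))))

  -- The number x divides Xx, Xy = Yx and Xz = Zx, hence their gcd, which is X because x, y, z have
  -- no common factor. If X = 0, a nonzero Y or Z forces x = 0.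
  proportional⇒≤ : ∀ {x y z} → Coprime3 x y z → ∀ {X Y Z} → X * y ≡ Y * x → X * z ≡ Z * x →
    X ≢ 0 ⊎ Y ≢ 0 ⊎ Z ≢ 0 → x ≤ X
  proportional⇒≤ {x} {y} {z} cop {suc X} {Y} {Z} Xy≡Yx Xz≡Zx _ = ∣⇒≤ (subst (x ∣_) X*gcd≡X
      (gcd-greatest (divides (suc X) refl) (subst (x ∣_) (sym (c*gcd[m,n]≡gcd[cm,cn] (suc X) y z))
        (gcd-greatest (divides Y Xy≡Yx) (divides Z Xz≡Zx)))))
    where
    X*gcd≡X : gcd (suc X * x) (suc X * gcd y z) ≡ suc X
    X*gcd≡X = trans (sym (c*gcd[m,n]≡gcd[cm,cn] (suc X) x (gcd y z)))
      (trans (cong (suc X *_) (coprime3⇒gcd≡1 cop)) (*-identityʳ (suc X)))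
  proportional⇒≤ {x} cop {zero} {Y} {Z} 0≡Yx 0≡Zx nonzero = ≤-reflexive (x≡0 nonzero)
    where
    x≡0 : 0 ≢ 0 ⊎ Y ≢ 0 ⊎ Z ≢ 0 → x ≡ 0
    x≡0 (inj₁ 0≢0) = contradiction refl 0≢0
    x≡0 (inj₂ (inj₁ Y≢0)) = [ (λ Y≡0 → contradiction Y≡0 Y≢0) , (λ x≡0 → x≡0) ]′ (m*n≡0⇒m≡0∨n≡0 Y (sym 0≡Yx))
    x≡0 (inj₂ (inj₂ Z≢0)) = [ (λ Z≡0 → contradiction Z≡0 Z≢0) , (λ x≡0 → x≡0) ]′ (m*n≡0⇒m≡0∨n≡0 Z (sym 0≡Zx))

  odd-factor : ∀ m n → Odd (m * n) → Odd n
  odd-factor m n odd with n%2≡0∨1 n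
  ... | inj₂ n-odd = n-odd
  ... | inj₁ n-even = contradiction (trans (sym odd) (trans (cong (_% 2) halved) ([m+kn]%n≡m%n 0 (m * (n / 2)) 2))) λ ()
    where
    halved : m * n ≡ m * (n / 2) * 2
    halved = trans (cong (m *_) (trans (m≡m%n+[m/n]*n n 2) (cong (_+ n / 2 * 2) n-even))) (sym (*-assoc m (n / 2) 2))

  sum≤ : ∀ {x y z B} → x ≤ B → y ≤ B → z ≤ B → x + y + z ≤ B + B + B
  sum≤ x≤B y≤B z≤B = +-mono-≤ (+-mono-≤ x≤B y≤B) z≤B

  -- Each letter is at most 50·2, the bounds for a primitive coordinate and for the common factor,
  -- so its square is at most 10000.
  3*10⁴<10⁶ : 10000 + 10000 + 10000 < 10 ^ 6
  3*10⁴<10⁶ = <ᵇ⇒< 30000 (10 ^ 6) _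

  module _ {t e a b : ℕ} (eoo : EvenOddOdd t e a b) where

    a-odd : Odd a
    a-odd = proj₁ (proj₂ eoo)

    norm : e * e + a * a + b * b ≡ t
    norm = proj₁ (proj₂ (proj₂ (proj₂ eoo)))

    unique : UniqueUpToPerm t e a b
    unique = proj₂ (proj₂ (proj₂ (proj₂ eoo)))

    -- Let q be a prime divisor of g = hq; it is odd because a is. If q missed a coordinate of (x,
    -- y, z), `secondRep` would give w of norm q²(x² + y² + z²) with q not dividing w₁. Then hw has
    -- norm t, so by uniqueness ∣hw₁∣ is a multiple of hq and q divides w₁ after all. Thus q divides
    -- x, y and z, against coprimality.
    smallFactor : ∀ {g x y z} → e ≡ x * g → a ≡ y * g → b ≡ z * g → Coprime3 x y z → g ≤ 2
    smallFactor {g} {x} {y} {z} refl refl refl cop = ≮⇒≥ λ 2<g → impossible (primeDivisor g (<-trans (n<1+n 1) 2<g))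
      where
      impossible : ∃[ q ] (Prime q × q ∣ g) → ⊥
      impossible (q , pr , divides h refl) = nonTrivial⇒≢1 {{prime⇒nonTrivial pr}}
          -- The coordinate under test comes last, the position in which `secondRep` expects the
          -- entry not divisible by q.
          (cop (q∣ y z x (rotate₁ x y z)) (q∣ x z y (rotate₂ x y z)) (q∣ x y z refl))
        where
        rotate₁ : ∀ x y z → y * y + z * z + x * x ≡ x * x + y * y + z * z
        rotate₁ = solve-∀
        rotate₂ : ∀ x y z → x * x + z * z + y * y ≡ x * x + y * y + z * z
        rotate₂ = solve-∀

        q-odd : Odd q
        q-odd = odd-factor (y * h) q (trans (cong (_% 2) (*-assoc y h q)) a-odd)

        h≢0 : h ≢ 0
        h≢0 refl = contradiction (trans (sym a-odd) (cong (_% 2) (*-zeroʳ y))) λ ()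

        q≡ : q ≡ suc (q / 2 + q / 2)
        q≡ = trans (m≡m%n+[m/n]*n q 2) (cong₂ _+_ q-odd (double (q / 2)))
          where
          double : ∀ k → k * 2 ≡ k + k
          double = solve-∀

        q∣ : ∀ X Y Z → X * X + Y * Y + Z * Z ≡ x * x + y * y + z * z → q ∣ Z
        q∣ X Y Z same = [ (λ q∣Z → q∣Z) , (λ q∤Z → ⊥-elim (rescale (secondRep {h = q / 2} pr q≡ (+ X) (+ Y) (+ Z) q∤Z))) ]′
            (toSum (q ∣? Z))
          where
          open ≡-Reasoning
          expand : ∀ h x y z → h ⊗ x ⊗ (h ⊗ x) ⊕ h ⊗ y ⊗ (h ⊗ y) ⊕ h ⊗ z ⊗ (h ⊗ z) ≡ h ⊗ h ⊗ (x ⊗ x ⊕ y ⊗ y ⊕ z ⊗ z)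
          expand = IntSolver.solve-∀
          collect : ∀ h q N → h * h * (q * q * N) ≡ N * (h * q * (h * q))
          collect = solve-∀
          distribute : ∀ x y z g → (x * x + y * y + z * z) * (g * g) ≡ x * g * (x * g) + y * g * (y * g) + z * g * (z * g)
          distribute = solve-∀
          N = X * X + Y * Y + Z * Z
          pos-N : + X ⊗ + X ⊕ + Y ⊗ + Y ⊕ + Z ⊗ + Z ≡ + N
          pos-N = sym (cong₂ _⊕_ (cong₂ _⊕_ (ℤₚ.pos-* X X) (ℤₚ.pos-* Y Y)) (ℤₚ.pos-* Z Z))
          rescale : ∃[ w₁ ] ∃[ w₂ ] ∃[ w₃ ] (¬ (q ∣ ∣ w₁ ∣) ×
            w₁ ⊗ w₁ ⊕ w₂ ⊗ w₂ ⊕ w₃ ⊗ w₃ ≡ + q ⊗ + q ⊗ (+ X ⊗ + X ⊕ + Y ⊗ + Y ⊕ + Z ⊗ + Z)) → ⊥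
          rescale (w₁ , w₂ , w₃ , q∤w₁ , w-norm) =
              q∤w₁ (coordinate (unique (+ h ⊗ w₁) (+ h ⊗ w₂) (+ h ⊗ w₃) hw-norm))
            where
            hw-norm : + h ⊗ w₁ ⊗ (+ h ⊗ w₁) ⊕ + h ⊗ w₂ ⊗ (+ h ⊗ w₂) ⊕ + h ⊗ w₃ ⊗ (+ h ⊗ w₃) ≡ + t
            hw-norm = begin
              _                                                       ≡⟨ expand (+ h) w₁ w₂ w₃ ⟩
              + h ⊗ + h ⊗ (w₁ ⊗ w₁ ⊕ w₂ ⊗ w₂ ⊕ w₃ ⊗ w₃)                 ≡⟨ cong (+ h ⊗ + h ⊗_) (trans w-norm (cong (+ q ⊗ + q ⊗_) pos-N)) ⟩
              + h ⊗ + h ⊗ (+ q ⊗ + q ⊗ + N)                           ≡⟨ cong₂ _⊗_ (sym (ℤₚ.pos-* h h)) (trans (cong (_⊗ + N) (sym (ℤₚ.pos-* q q))) (sym (ℤₚ.pos-* (q * q) N))) ⟩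
              + (h * h) ⊗ + (q * q * N)                               ≡⟨ ℤₚ.pos-* (h * h) (q * q * N) ⟨
              + (h * h * (q * q * N))                                 ≡⟨ cong +_ (collect h q N) ⟩
              + (N * (h * q * (h * q)))                               ≡⟨ cong (λ n → + (n * (h * q * (h * q)))) same ⟩
              + ((x * x + y * y + z * z) * (h * q * (h * q)))         ≡⟨ cong +_ (trans (distribute x y z (h * q)) norm) ⟩
              + t                                                     ∎
            multiple : ∀ m → ∣ + h ⊗ w₁ ∣ ≡ m * (h * q) → q ∣ ∣ w₁ ∣
            multiple m eq = divides m (*-cancelˡ-≡ ∣ w₁ ∣ (m * q) h {{≢-nonZero h≢0}} (trans (sym (ℤₚ.abs-* (+ h) w₁)) (trans eq (swap m h q))))
              where
              swap : ∀ m h q → m * (h * q) ≡ h * (m * q)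
              swap = solve-∀
            coordinate : ∀ {v w} → Perm3 (x * (h * q)) (y * (h * q)) (z * (h * q)) (∣ + h ⊗ w₁ ∣) v w → q ∣ ∣ w₁ ∣
            coordinate π with ∣ + h ⊗ w₁ ∣ in eq | π
            ... | _ | abc = multiple x eq
            ... | _ | acb = multiple x eq
            ... | _ | bac = multiple y eq
            ... | _ | bca = multiple y eq
            ... | _ | cab = multiple z eq
            ... | _ | cba = multiple z eq

    module _ (t≥10⁶ : t ≥ 10 ^ 6) where

      -- A nonzero (X, Y, Z) parallel to (e, a, b) bounds the primitive triple by 50 through
      -- `proportional⇒≤`. With g ≤ 2 each letter is at most 100, so t ≤ 30000.
      noSmallProportion : ∀ X Y Z → X * a ≡ Y * e → X * b ≡ Z * e → Y * b ≡ Z * a →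
        X ≤ 50 → Y ≤ 50 → Z ≤ 50 → ¬ (X ≢ 0 ⊎ Y ≢ 0 ⊎ Z ≢ 0)
      noSmallProportion X Y Z Xa≡Ye Xb≡Ze Yb≡Za X≤50 Y≤50 Z≤50 nonzero = bound (commonFactor e a b a≢0)
        where
        a≢0 : a ≢ 0
        a≢0 a≡0 = contradiction (trans (sym a-odd) (cong (_% 2) a≡0)) λ ()
        bound : ¬ (∃[ g ] ∃[ x ] ∃[ y ] ∃[ z ] (e ≡ x * g × a ≡ y * g × b ≡ z * g × Coprime3 x y z))
        bound (g , x , y , z , e≡ , a≡ , b≡ , cop) = <⇒≱ t<10⁶ t≥10⁶
          where
          g≤2 : g ≤ 2
          g≤2 = smallFactor e≡ a≡ b≡ cop
          g≢0 : g ≢ 0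
          g≢0 g≡0 = a≢0 (trans a≡ (trans (cong (y *_) g≡0) (*-zeroʳ y)))
          cancel : ∀ {u v m n} C D → u ≡ m * g → v ≡ n * g → C * u ≡ D * v → C * m ≡ D * n
          cancel {m = m} {n} C D refl refl eq = *-cancelʳ-≡ (C * m) (D * n) g {{≢-nonZero g≢0}}
            (trans (*-assoc C m g) (trans eq (sym (*-assoc D n g))))
          Xy≡Yx = cancel X Y a≡ e≡ Xa≡Ye
          Xz≡Zx = cancel X Z b≡ e≡ Xb≡Ze
          Yz≡Zy = cancel Y Z b≡ a≡ Yb≡Za
          x≤50 : x ≤ 50
          x≤50 = ≤-trans (proportional⇒≤ cop Xy≡Yx Xz≡Zx nonzero) X≤50
          y≤50 : y ≤ 50
          y≤50 = ≤-trans (proportional⇒≤ {y} {x} {z} (λ dy dx dz → cop dx dy dz) (sym Xy≡Yx) Yz≡Zy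
            ([ (λ X≢0 → inj₂ (inj₁ X≢0)) , [ inj₁ , (λ Z≢0 → inj₂ (inj₂ Z≢0)) ]′ ]′ nonzero)) Y≤50
          z≤50 : z ≤ 50
          z≤50 = ≤-trans (proportional⇒≤ {z} {x} {y} (λ dz dx dy → cop dx dy dz) (sym Xz≡Zx) (sym Yz≡Zy)
            ([ (λ X≢0 → inj₂ (inj₁ X≢0)) , [ (λ Y≢0 → inj₂ (inj₂ Y≢0)) , inj₁ ]′ ]′ nonzero)) Z≤50
          square≤ : ∀ {u m} → u ≡ m * g → m ≤ 50 → u * u ≤ 10000
          square≤ refl m≤50 = *-mono-≤ (*-mono-≤ m≤50 g≤2) (*-mono-≤ m≤50 g≤2)
          t<10⁶ : t < 10 ^ 6
          t<10⁶ = subst (_< 10 ^ 6) norm (≤-<-trans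
            (sum≤ (square≤ e≡ x≤50) (square≤ a≡ y≤50) (square≤ b≡ z≤50)) 3*10⁴<10⁶)

      -- The vector (e, a, b) is orthogonal to both coefficient vectors, hence parallel to their
      -- cross product (X, Y, Z), whose entries are at most 25 + 25. By `noSmallProportion` that
      -- product vanishes; the two required equations are Z = 0 and Y = 0.
      proportional : Letters.Proportional e a b
      proportional α β γ α′ β′ γ′ α≤ β≤ γ≤ α′≤ β′≤ γ′≤ rel rel′ =
          decidable-stable (α ⊗ β′ ℤ.≟ β ⊗ α′) (λ ≢ → no (inj₂ (inj₂ (distinct ≢)))) ,
          decidable-stable (α ⊗ γ′ ℤ.≟ γ ⊗ α′) (λ ≢ → no (inj₂ (inj₁ (distinct (λ eq → ≢ (sym eq))))))
        where
        X Y Z : ℤ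
        X = β ⊗ γ′ ⊖ γ ⊗ β′
        Y = γ ⊗ α′ ⊖ α ⊗ γ′
        Z = α ⊗ β′ ⊖ β ⊗ α′
        distinct : ∀ {i j} → i ≢ j → ∣ i ⊖ j ∣ ≢ 0
        distinct {i} {j} i≢j eq = i≢j (ℤₚ.i-j≡0⇒i≡j i j (ℤₚ.∣i∣≡0⇒i≡0 eq))
        ≤25 : ∀ {i j} → ∣ i ∣ ≤ 5 → ∣ j ∣ ≤ 5 → ∣ i ⊗ j ∣ ≤ 25
        ≤25 {i} {j} i≤5 j≤5 = subst (_≤ 25) (sym (ℤₚ.abs-* i j)) (*-mono-≤ i≤5 j≤5)
        ≤50 : ∀ i j → ∣ i ∣ ≤ 25 → ∣ j ∣ ≤ 25 → ∣ i ⊖ j ∣ ≤ 50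
        ≤50 i j i≤25 j≤25 = ≤-trans (ℤₚ.∣i-j∣≤∣i∣+∣j∣ i j) (+-mono-≤ i≤25 j≤25)
        to∣∣ : ∀ C D {u v} → C ⊗ + u ≡ D ⊗ + v → ∣ C ∣ * u ≡ ∣ D ∣ * v
        to∣∣ C D {u} {v} eq = trans (sym (ℤₚ.abs-* C (+ u))) (trans (cong ∣_∣ eq) (ℤₚ.abs-* D (+ v)))
        -- (r × s) × v = (r · v) s − (s · v) r for the coefficient vectors r and s.
        eliminate : ∀ {u v r s} i j → u ≡ v ⊕ (r ⊗ i ⊖ s ⊗ j) → r ≡ 0ℤ → s ≡ 0ℤ → u ≡ v
        eliminate {v = v} i j eq refl refl = trans eq (ℤₚ.+-identityʳ v)
        Xa≡Ye : X ⊗ + a ≡ Y ⊗ + e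
        Xa≡Ye = eliminate γ′ γ (identity α β γ α′ β′ γ′ (+ e) (+ a) (+ b)) rel rel′
          where
          identity : ∀ α β γ α′ β′ γ′ e a b → (β ⊗ γ′ ⊖ γ ⊗ β′) ⊗ a ≡ (γ ⊗ α′ ⊖ α ⊗ γ′) ⊗ e ⊕
            ((α ⊗ e ⊕ β ⊗ a ⊕ γ ⊗ b) ⊗ γ′ ⊖ (α′ ⊗ e ⊕ β′ ⊗ a ⊕ γ′ ⊗ b) ⊗ γ)
          identity = IntSolver.solve-∀
        Xb≡Ze : X ⊗ + b ≡ Z ⊗ + e
        Xb≡Ze = eliminate (ℤ.- β′) (ℤ.- β) (identity α β γ α′ β′ γ′ (+ e) (+ a) (+ b)) rel rel′
          where
          identity : ∀ α β γ α′ β′ γ′ e a b → (β ⊗ γ′ ⊖ γ ⊗ β′) ⊗ b ≡ (α ⊗ β′ ⊖ β ⊗ α′) ⊗ e ⊕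
            ((α ⊗ e ⊕ β ⊗ a ⊕ γ ⊗ b) ⊗ ℤ.- β′ ⊖ (α′ ⊗ e ⊕ β′ ⊗ a ⊕ γ′ ⊗ b) ⊗ ℤ.- β)
          identity = IntSolver.solve-∀
        Yb≡Za : Y ⊗ + b ≡ Z ⊗ + a
        Yb≡Za = eliminate α′ α (identity α β γ α′ β′ γ′ (+ e) (+ a) (+ b)) rel rel′
          where
          identity : ∀ α β γ α′ β′ γ′ e a b → (γ ⊗ α′ ⊖ α ⊗ γ′) ⊗ b ≡ (α ⊗ β′ ⊖ β ⊗ α′) ⊗ a ⊕
            ((α ⊗ e ⊕ β ⊗ a ⊕ γ ⊗ b) ⊗ α′ ⊖ (α′ ⊗ e ⊕ β′ ⊗ a ⊕ γ′ ⊗ b) ⊗ α)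
          identity = IntSolver.solve-∀
        no : ¬ (∣ X ∣ ≢ 0 ⊎ ∣ Y ∣ ≢ 0 ⊎ ∣ Z ∣ ≢ 0)
        no = noSmallProportion (∣ X ∣) (∣ Y ∣) (∣ Z ∣) (to∣∣ X Y Xa≡Ye) (to∣∣ X Z Xb≡Ze) (to∣∣ Y Z Yb≡Za)
          (≤50 (β ⊗ γ′) (γ ⊗ β′) (≤25 {β} {γ′} β≤ γ′≤) (≤25 {γ} {β′} γ≤ β′≤))
          (≤50 (γ ⊗ α′) (α ⊗ γ′) (≤25 {γ} {α′} γ≤ α′≤) (≤25 {α} {γ′} α≤ γ′≤))
          (≤50 (α ⊗ β′) (β ⊗ α′) (≤25 {α} {β′} α≤ β′≤) (≤25 {β} {α′} β≤ α′≤))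

-- Assembling the bound on the least odd length.

open import Data.Nat using (_+_; _*_; _/_; _%_; _≤_)
open import Data.Nat.DivMod using (m≡m%n+[m/n]*n)
open import Data.Nat.Properties using (≰⇒>; n≢0⇒n>0; *-zeroʳ; <⇒≢)
open import Data.Nat.Tactic.RingSolver using (solve-∀)
open import Data.Product using (_,_)
open import Data.Sum using (inj₁; inj₂)
open import Relation.Binary.PropositionalEquality using (_≢_; refl; sym; trans; cong₂; subst)
open import Relation.Nullary using (¬_)
open EisensteinForm using (squareFree-obstruction)
open Walks using (oddClosedWalk; oddClosedWalk⇒C)
open Representations using (EvenOddOdd; evenOddOdd)
open Columns using (SumRelation; module Letters; module ShortWalks)
open SmallRelations using (proportional)

sumRelation⇒form : ∀ {t e a b} → e * e + a * a + b * b ≡ t → SumRelation e a b →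
                   ∃[ x ] ∃[ y ] t ≡ 2 * (x * x + x * y + y * y)
sumRelation⇒form {a = a} {b} norm (inj₁ refl) = a , b , trans (sym norm) (identity a b)
  where
  identity : ∀ a b → (a + b) * (a + b) + a * a + b * b ≡ 2 * (a * a + a * b + b * b)
  identity = solve-∀
sumRelation⇒form {e = e} {b = b} norm (inj₂ (inj₁ refl)) = e , b , trans (sym norm) (identity e b)
  where
  identity : ∀ e b → e * e + (e + b) * (e + b) + b * b ≡ 2 * (e * e + e * b + b * b)
  identity = solve-∀
sumRelation⇒form {e = e} {a} norm (inj₂ (inj₂ refl)) = e , a , trans (sym norm) (identity e a)
  where
  identity : ∀ e a → e * e + a * a + (e + a) * (e + a) ≡ 2 * (e * e + e * a + a * a)
  identity = solve-∀

T⇒¬form : ∀ {t} → T t → ¬ (∃[ x ] ∃[ y ] t ≡ 2 * (x * x + x * y + y * y))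
T⇒¬form (0<t , _ , s , (sf , k , refl) , p , pr , p-odd , p≡2 , p∣s) (x , y , eq) =
  squareFree-obstruction pr p-odd p≡2 sf p∣s k (n≢0⇒n>0 k≢0) x y eq
  where
  k≢0 : k ≢ 0
  k≢0 refl = <⇒≢ 0<t (sym (*-zeroʳ s))

even-sum : ∀ e a b → e % 2 ≡ 0 → Odd a → Odd b → ∃[ h ] e + a + b ≡ 2 * h
-- The final 1 is half of the two remainders left by the odd numbers a and b.
even-sum e a b e-even a-odd b-odd = e / 2 + a / 2 + b / 2 + 1 ,
  trans (cong₂ _+_ (cong₂ _+_ (halve e e-even) (halve a a-odd)) (halve b b-odd)) (collect (e / 2) (a / 2) (b / 2))
  where
  halve : ∀ n {r} → n % 2 ≡ r → n ≡ r + n / 2 * 2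
  halve n refl = m≡m%n+[m/n]*n n 2
  collect : ∀ e a b → 0 + e * 2 + (1 + a * 2) + (1 + b * 2) ≡ 2 * (e + a + b + 1)
  collect = solve-∀

theorem7 : (t : ℕ) → T t → t ≥ 10 ^ 6 → P t ≡ 1 → ∃[ c ] (C 3 [ t ]≔ c × c > 5)
theorem7 t t∈T@(_ , t≡2 , _) t≥10⁶ P≡1 = fromRep (evenOddOdd t≡2 P≡1)
  where
  fromRep : ∃[ e ] ∃[ a ] ∃[ b ] EvenOddOdd t e a b → ∃[ c ] (C 3 [ t ]≔ c × c > 5)
  fromRep (e , a , b , eoo@(e-even , a-odd , b-odd , norm , unique)) = fromSum (even-sum e a b e-even a-odd b-odd)
    where
    noShortWalk : ∀ {n} → Odd n → ClosedWalk 3 t n → ¬ (n ≤ 5)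
    noShortWalk odd (vs , norms , closed) n≤5 =
      ShortWalks.noTally e a b e-even a-odd b-odd (λ sum → T⇒¬form t∈T (sumRelation⇒form norm sum))
        (proportional eoo t≥10⁶) odd n≤5 (subst (Letters.Tally e a b _) closed (Letters.walkTally e a b unique vs norms))
    fromC : ∃[ c ] (C 3 [ t ]≔ c × Odd c × ClosedWalk 3 t c) → ∃[ c ] (C 3 [ t ]≔ c × c > 5)
    fromC (c , C≔c , odd , walk) = c , C≔c , ≰⇒> (noShortWalk odd walk)
    fromWalk : ∃[ n ] (Odd n × ClosedWalk 3 t n) → ∃[ c ] (C 3 [ t ]≔ c × c > 5)
    fromWalk (n , odd , walk) = fromC (oddClosedWalk⇒C odd walk)
    fromSum : ∃[ h ] e + a + b ≡ 2 * h → ∃[ c ] (C 3 [ t ]≔ c × c > 5)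
    fromSum (h , S≡2h) = fromWalk (oddClosedWalk e a b h a-odd S≡2h norm)
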